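{- For the secretary ranking problem with $m=n$ positions, there exists an algorithm whose output ranking has $O(n\sqrt{n})$ inversions in expectation.
   Context: Secretary ranking problem: there are $n$ elements with distinct values from a totally ordered set, and $m\ge n$ positions $1,\dots,m$ (here $m=n$). The elements arrive online in a uniformly random order; $a_t$ denotes the element arriving at time $t$, and $\mathrm{rk}(a)\in[n]$ denotes the true rank of element $a$ in the total order. At time $t$ the algorithm only knows the outcomes of pairwise comparisons among $a_1,\dots,a_t$, and must irrevocably assign $a_t$ a position $\pi(a_t)\in[m]$ not assigned to any earlier element. The cost is the number of inversions $|\{(i,j): (\pi(a_i)-\pi(a_j))(\mathrm{rk}(a_i)-\mathrm{rk}(a_j))<0\}|$. Expectations are over the random arrival order and the algorithm's internal randomness. -}

module Defs where

open import Data.Bool using (Bool; true; false; _∧_; _∨_; not; if_then_else_; T)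
open import Data.Nat using (ℕ; zero; suc; _+_; _*_; _^_; _≤_; _<ᵇ_; NonZero)
open import Data.Fin using (Fin; toℕ; inject≤; _≟_)
open import Data.Fin.Properties using (toℕ<n)
open import Data.List using (List; []; _∷_; [_]; map; concatMap; allFin)
open import Data.Nat.ListAction using (sum)
open import Data.Bool.ListAction using (any)
open import Data.Vec using (Vec; lookup; toList) renaming ([] to []ᵥ; _∷_ to _∷ᵥ_)
open import Relation.Binary.PropositionalEquality using (_≡_)
open import Relation.Nullary.Decidable using (⌊_⌋)

_<F_ : ∀ {n} → Fin n → Fin n → Bool
i <F j = toℕ i <ᵇ toℕ j

sumFin : (n : ℕ) → (Fin n → ℕ) → ℕ
sumFin n f = sum (map f (allFin n))

𝟙 : Bool → ℕ
𝟙 true  = 1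
𝟙 false = 0

allVecs : (n k : ℕ) → List (Vec (Fin n) k)
allVecs n zero    = [ []ᵥ ]
allVecs n (suc k) = concatMap (λ v → map (_∷ᵥ v) (allFin n)) (allVecs n k)

distinct : ∀ {n} → List (Fin n) → Bool
distinct []       = true
distinct (x ∷ xs) = not (any (λ y → ⌊ x ≟ y ⌋) xs) ∧ distinct xs

-- An arrival order: σ : Vec (Fin n) n with σ[t] = rk(a_t) (0-based ranks).
-- It is a valid arrival order iff it is a permutation of Fin n.
isPerm : ∀ {n} → Vec (Fin n) n → Bool
isPerm σ = distinct (toList σ)

embed : ∀ {n} (t : Fin n) → Fin (suc (toℕ t)) → Fin n
embed t i = inject≤ i (toℕ<n t)

-- Comparison outcomes among a_0,…,a_t (0-based times) known at time t.
History : ∀ {n} → Fin n → Set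
History t = Fin (suc (toℕ t)) → Fin (suc (toℕ t)) → Bool

history : ∀ {n} (σ : Vec (Fin n) n) (t : Fin n) → History t
history σ t i j = lookup σ (embed t i) <F lookup σ (embed t j)

-- A randomized online algorithm for m = n positions. For instance size n it
-- draws a uniformly random seed from Fin (seeds n); at time t it chooses the
-- position of a_t as a function of n, the seed and the pairwise comparisons
-- among a_0,…,a_t only (its own earlier choices are determined by these).
record Algorithm : Set where
  field
    seeds    : ℕ → ℕ
    seeds≢0  : ∀ n → NonZero (seeds n)
    place    : (n : ℕ) → Fin (seeds n) → (t : Fin n) → History t → Fin n

open Algorithm public

position : (A : Algorithm) (n : ℕ) → Fin (seeds A n) → Vec (Fin n) n → Fin n → Fin n
position A n s σ t = place A n s t (history σ t)

Valid : Algorithm → Set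
Valid A = ∀ n (s : Fin (seeds A n)) (σ : Vec (Fin n) n) → T (isPerm σ) →
          ∀ t u → position A n s σ t ≡ position A n s σ u → t ≡ u

-- number of inversions: ordered pairs (i , j) of times with
-- (π(a_i) - π(a_j)) (rk(a_i) - rk(a_j)) < 0
inversions : (n : ℕ) → (pos : Fin n → Fin n) → (rk : Fin n → Fin n) → ℕ
inversions n pos rk =
  sumFin n λ i → sumFin n λ j →
    𝟙 ((pos i <F pos j ∧ rk j <F rk i) ∨ (pos j <F pos i ∧ rk i <F rk j))

totalCost : Algorithm → ℕ → ℕ
totalCost A n =
  sum (map (λ σ → if isPerm σ
                  then sumFin (seeds A n) (λ s → inversions n (position A n s σ) (lookup σ))
                  else 0)
           (allVecs n n))

outcomes : Algorithm → ℕ → ℕ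
outcomes A n = sum (map (λ σ → 𝟙 (isPerm σ)) (allVecs n n)) * seeds A n

-- expected cost  E = totalCost / outcomes  is O(n √n):
-- ∃ C N₀, ∀ n ≥ N₀, E ≤ C n^{3/2}, squared and cleared of denominators
-- (a natural constant C standing for the square of the real constant).
ExpectedInversionsO-n√n : Algorithm → Set
ExpectedInversionsO-n√n A =
  Σ' ℕ λ C → Σ' ℕ λ N₀ → ∀ n → N₀ ≤ n →
    totalCost A n ^ 2 ≤ C * n ^ 3 * outcomes A n ^ 2
  where
  open import Data.Product using () renaming (Σ to Σ')

{-# OPTIONS --safe #-}

-- Idea.  Let r ∈ [0, s] be the rank of a_s among a_0, …, a_s.  The ranks are independent and uniform,
-- so with fresh randomness r is coupled monotonically with a uniform c ∈ [0, n − s) such that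
-- c / (n − s) ≈ r / (s + 1); a_s is put into the c-th free slot.  The final rank of a_t arises from
-- its relative rank by the insertions of a_{t+1}, …, a_{n−1}, and dually its slot arises from c by
-- re-inserting the slots taken at times t − 1, …, 0.  Both are the same Pólya-type martingale, which
-- gives mean square errors of order n² / t and n² / (n − t).  Hence the expected displacement of a_t
-- is O(n / √t + n / √(n − t)), which sums to O(n √n), and the number of inversions is at most a
-- constant times the total displacement.
module Submission where

open import Defs
open import Data.Product using (Σ; _×_)

open import Data.Bool using (Bool; true; false; _∧_; _∨_; not; if_then_else_; T; T?)
open import Data.Bool.ListAction using (any)
open import Data.Bool.Properties using (T-∧)
open import Data.Fin using (Fin; toℕ; fromℕ<; punchIn; punchOut) renaming (_≟_ to _≟F_)
open import Data.Fin.Properties using (toℕ<n; toℕ-fromℕ<; toℕ-inject≤; toℕ-injective; punchIn-injective; punchIn-punchOut)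
open import Data.List using (List; []; _∷_; [_]; map; _++_; length; upTo; allFin; tabulate; cartesianProductWith; concatMap; filterᵇ)
import Data.List as List
open import Data.List.Membership.Propositional using (_∈_)
open import Data.List.Membership.Propositional.Properties using (∈-upTo⁻; ∈-allFin; ∈-filter⁺; ∈-filter⁻; ∈-cartesianProductWith⁺; ∈-cartesianProductWith⁻)
open import Data.List.Membership.Propositional.Properties.WithK using (unique∧set⇒bag)
open import Data.List.Properties using (map-++; map-∘; map-tabulate; upTo-∷ʳ; length-upTo; length-++; length-map; length-tabulate; tabulate-lookup)
open import Data.List.Relation.Binary.BagAndSetEquality using (∼bag⇒↭)
open import Data.List.Relation.Binary.Permutation.Propositional using (_↭_)
open import Data.List.Relation.Binary.Permutation.Propositional.Properties using (map⁺)
open import Data.List.Relation.Unary.All using () renaming ([] to []ᴬ)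
open import Data.List.Relation.Unary.AllPairs using () renaming ([] to []ᴾ; _∷_ to _∷ᴾ_)
open import Data.List.Relation.Unary.Any using (here; there)
open import Data.List.Relation.Unary.Unique.Propositional using (Unique)
open import Data.List.Relation.Unary.Unique.Propositional.Properties using (cartesianProductWith⁺; allFin⁺; filter⁺)
open import Data.Nat
open import Data.Nat.DivMod using (_/_; _%_; m≡m%n+[m/n]*n; m%n<n; m<n*o⇒m/o<n; m/n*n≤m; m*n/n≡m; m<n⇒m/n≡0; +-distrib-/-∣ˡ; m<n⇒m%n≡m)
open import Data.Nat.Divisibility using (n∣m*n)
open import Data.Nat.ListAction using (sum)
open import Data.Nat.ListAction.Properties using (sum-++; sum-↭)
open import Data.Nat.Properties
open import Data.Nat.Tactic.RingSolver using (solve-∀)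
open import Data.Product using (_,_; proj₁; proj₂; ∃)
open import Data.Sum using (inj₁; inj₂)
open import Data.Vec using (Vec; []; _∷_; lookup; _∷ʳ_; initLast; toList)
import Data.Vec as Vec
open import Data.Vec.Properties using (∷ʳ-injective; ∷-injective)
open import Function using (_∘_; id; mk⇔; Equivalence)
open import Relation.Binary.Definitions using (tri<; tri≈; tri>)
open import Relation.Binary.PropositionalEquality hiding ([_]; J)
open import Relation.Nullary using (yes; no; ¬_; contradiction)
open import Relation.Nullary.Decidable using (⌊_⌋)

-- Everything is stated in ℕ: expectations become sums over lists of outcomes, square roots appear
-- only squared, and denominators are cleared. With k items present, the martingale is `Y` / (k + 1)
-- for a 1-based rank `Y`; the scales `2 + t`, `suc (room n t)` and `suc n` are such values k + 1.
-- The internal randomness removes one obstacle. Rounding r (n - s) / (s + 1) deterministically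
-- would make c only roughly uniform, and a bias in every round would spoil the martingale of the
-- slots. The seed makes c exactly uniform and independent of the past. The price is a rounding
-- error between r and c, paid once per element. The errors in rank, in rounding and in slot are
-- combined by the triangle inequality and second moments, so their joint law never matters.

private variable
  A B C : Set

-- Sums over lists and over initial segments of ℕ.

∑ : List A → (A → ℕ) → ℕ
∑ xs f = sum (map f xs)

∑-cong : ∀ (xs : List A) {f g : A → ℕ} → (∀ x → x ∈ xs → f x ≡ g x) → ∑ xs f ≡ ∑ xs g
∑-cong []       eq = refl
∑-cong (x ∷ xs) eq = cong₂ _+_ (eq x (here refl)) (∑-cong xs λ y y∈ → eq y (there y∈))

∑-mono : ∀ (xs : List A) {f g : A → ℕ} → (∀ x → x ∈ xs → f x ≤ g x) → ∑ xs f ≤ ∑ xs g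
∑-mono []       le = z≤n
∑-mono (x ∷ xs) le = +-mono-≤ (le x (here refl)) (∑-mono xs λ y y∈ → le y (there y∈))

∑-const : ∀ (xs : List A) k → ∑ xs (λ _ → k) ≡ length xs * k
∑-const []       k = refl
∑-const (x ∷ xs) k = cong (k +_) (∑-const xs k)

∑-+ : ∀ (xs : List A) (f g : A → ℕ) → ∑ xs (λ x → f x + g x) ≡ ∑ xs f + ∑ xs g
∑-+ []       f g = refl
∑-+ (x ∷ xs) f g rewrite ∑-+ xs f g = lem (f x) (g x) (∑ xs f) (∑ xs g)
  where
  lem : ∀ a b c d → a + b + (c + d) ≡ a + c + (b + d)
  lem = solve-∀

∑-*ˡ : ∀ k (xs : List A) (f : A → ℕ) → ∑ xs (λ x → k * f x) ≡ k * ∑ xs f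
∑-*ˡ k []       f = sym (*-zeroʳ k)
∑-*ˡ k (x ∷ xs) f = trans (cong (k * f x +_) (∑-*ˡ k xs f)) (sym (*-distribˡ-+ k (f x) (∑ xs f)))

∑-swap : ∀ (xs : List A) (ys : List B) (f : A → B → ℕ) →
         ∑ xs (λ x → ∑ ys (f x)) ≡ ∑ ys (λ y → ∑ xs λ x → f x y)
∑-swap []       ys f = sym (trans (∑-const ys 0) (*-zeroʳ (length ys)))
∑-swap (x ∷ xs) ys f = trans (cong (∑ ys (f x) +_) (∑-swap xs ys f)) (sym (∑-+ ys (f x) _))

∑-++ : ∀ (xs ys : List A) (f : A → ℕ) → ∑ (xs ++ ys) f ≡ ∑ xs f + ∑ ys f
∑-++ xs ys f = trans (cong sum (map-++ f xs ys)) (sum-++ (map f xs) (map f ys))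

∑-map : ∀ (h : A → B) (xs : List A) (f : B → ℕ) → ∑ (map h xs) f ≡ ∑ xs (f ∘ h)
∑-map h xs f = cong sum (sym (map-∘ xs))

∑-cartesianProductWith : ∀ (h : A → B → C) xs ys (f : C → ℕ) →
  ∑ (cartesianProductWith h xs ys) f ≡ ∑ xs λ x → ∑ ys λ y → f (h x y)
∑-cartesianProductWith h []       ys f = refl
∑-cartesianProductWith h (x ∷ xs) ys f =
  trans (∑-++ (map (h x) ys) _ f) (cong₂ _+_ (∑-map (h x) ys f) (∑-cartesianProductWith h xs ys f))

∑-upTo-suc : ∀ n f → ∑ (upTo (suc n)) f ≡ ∑ (upTo n) f + f n
∑-upTo-suc n f = begin
  ∑ (upTo (suc n)) f         ≡⟨ cong (λ l → ∑ l f) (upTo-∷ʳ n) ⟨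
  ∑ (upTo n ++ [ n ]) f      ≡⟨ ∑-++ (upTo n) [ n ] f ⟩
  ∑ (upTo n) f + (f n + 0)   ≡⟨ cong (∑ (upTo n) f +_) (+-identityʳ (f n)) ⟩
  ∑ (upTo n) f + f n         ∎
  where open ≡-Reasoning

∑-upTo-cong : ∀ n {f g : ℕ → ℕ} → (∀ i → i < n → f i ≡ g i) → ∑ (upTo n) f ≡ ∑ (upTo n) g
∑-upTo-cong n eq = ∑-cong (upTo n) λ i i∈ → eq i (∈-upTo⁻ i∈)

∑-upTo-mono : ∀ n {f g : ℕ → ℕ} → (∀ i → i < n → f i ≤ g i) → ∑ (upTo n) f ≤ ∑ (upTo n) g
∑-upTo-mono n le = ∑-mono (upTo n) λ i i∈ → le i (∈-upTo⁻ i∈)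

∑-upTo-+ : ∀ m n f → ∑ (upTo (m + n)) f ≡ ∑ (upTo m) f + ∑ (upTo n) (λ i → f (m + i))
∑-upTo-+ m zero    f rewrite +-identityʳ m = sym (+-identityʳ _)
∑-upTo-+ m (suc n) f = begin
  ∑ (upTo (m + suc n)) f                                  ≡⟨ cong (λ k → ∑ (upTo k) f) (+-suc m n) ⟩
  ∑ (upTo (suc (m + n))) f                                ≡⟨ ∑-upTo-suc (m + n) f ⟩
  ∑ (upTo (m + n)) f + f (m + n)                          ≡⟨ cong (_+ f (m + n)) (∑-upTo-+ m n f) ⟩
  ∑ (upTo m) f + ∑ (upTo n) (λ i → f (m + i)) + f (m + n) ≡⟨ +-assoc (∑ (upTo m) f) _ _ ⟩
  ∑ (upTo m) f + (∑ (upTo n) (λ i → f (m + i)) + f (m + n))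
    ≡⟨ cong (∑ (upTo m) f +_) (∑-upTo-suc n (λ i → f (m + i))) ⟨
  ∑ (upTo m) f + ∑ (upTo (suc n)) (λ i → f (m + i))       ∎
  where open ≡-Reasoning

∑-upTo-* : ∀ a m (f : ℕ → ℕ) →
           ∑ (upTo a) (λ r → ∑ (upTo m) λ u → f (r * m + u)) ≡ ∑ (upTo (a * m)) f
∑-upTo-* zero    m f = refl
∑-upTo-* (suc a) m f = begin
  ∑ (upTo (suc a)) (λ r → ∑ (upTo m) λ u → f (r * m + u))
    ≡⟨ ∑-upTo-suc a (λ r → ∑ (upTo m) λ u → f (r * m + u)) ⟩
  ∑ (upTo a) (λ r → ∑ (upTo m) λ u → f (r * m + u)) + ∑ (upTo m) (λ u → f (a * m + u))
    ≡⟨ cong (_+ ∑ (upTo m) (λ u → f (a * m + u))) (∑-upTo-* a m f) ⟩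
  ∑ (upTo (a * m)) f + ∑ (upTo m) (λ u → f (a * m + u))
    ≡⟨ ∑-upTo-+ (a * m) m f ⟨
  ∑ (upTo (a * m + m)) f
    ≡⟨ cong (λ k → ∑ (upTo k) f) (+-comm (a * m) m) ⟩
  ∑ (upTo (m + a * m)) f ∎
  where open ≡-Reasoning

∑-upTo-reverse : ∀ n (f : ℕ → ℕ) → ∑ (upTo n) f ≡ ∑ (upTo n) (λ i → f (n ∸ suc i))
∑-upTo-reverse zero    f = refl
∑-upTo-reverse (suc n) f = begin
  ∑ (upTo (suc n)) f                      ≡⟨ ∑-upTo-suc n f ⟩
  ∑ (upTo n) f + f n                      ≡⟨ cong (_+ f n) (∑-upTo-reverse n f) ⟩
  ∑ (upTo n) (λ i → f (n ∸ suc i)) + f n  ≡⟨ +-comm _ (f n) ⟩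
  f n + ∑ (upTo n) (λ i → f (n ∸ suc i))
    ≡⟨ cong (_+ ∑ (upTo n) (λ i → f (n ∸ suc i))) (+-identityʳ (f n)) ⟨
  ∑ (upTo 1) (λ i → f (n ∸ i)) + ∑ (upTo n) (λ i → f (n ∸ suc i))
    ≡⟨ ∑-upTo-+ 1 n (λ i → f (n ∸ i)) ⟨
  ∑ (upTo (suc n)) (λ i → f (n ∸ i))      ∎
  where open ≡-Reasoning

∑-allFin : ∀ n (f : ℕ → ℕ) → ∑ (allFin n) (f ∘ toℕ) ≡ ∑ (upTo n) f
∑-allFin zero    f = refl
∑-allFin (suc n) f = begin
  f 0 + ∑ (tabulate {n = n} Fin.suc) (f ∘ toℕ)
    ≡⟨ cong (λ l → f 0 + ∑ l (f ∘ toℕ)) (map-tabulate {n = n} id Fin.suc) ⟨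
  f 0 + ∑ (map Fin.suc (allFin n)) (f ∘ toℕ)      ≡⟨ cong (f 0 +_) (∑-map Fin.suc (allFin n) (f ∘ toℕ)) ⟩
  f 0 + ∑ (allFin n) (λ i → f (suc (toℕ i)))      ≡⟨ cong (f 0 +_) (∑-allFin n (f ∘ suc)) ⟩
  f 0 + ∑ (upTo n) (f ∘ suc)                      ≡⟨ cong (_+ ∑ (upTo n) (f ∘ suc)) (+-identityʳ (f 0)) ⟨
  ∑ (upTo 1) f + ∑ (upTo n) (f ∘ suc)             ≡⟨ ∑-upTo-+ 1 n f ⟨
  ∑ (upTo (suc n)) f ∎
  where open ≡-Reasoning

∑-lookup : ∀ (xs : List A) (f : A → ℕ) → sumFin (length xs) (λ i → f (List.lookup xs i)) ≡ ∑ xs f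
∑-lookup xs f = cong sum (trans (map-tabulate id (f ∘ List.lookup xs))
  (trans (sym (map-tabulate (List.lookup xs) f)) (cong (map f) (tabulate-lookup xs))))

∑-≤-length : ∀ (xs : List A) {f : A → ℕ} {k} → (∀ x → x ∈ xs → f x ≤ k) → ∑ xs f ≤ length xs * k
∑-≤-length xs {k = k} le = ≤-trans (∑-mono xs le) (≤-reflexive (∑-const xs k))

-- Every quotient q is attained exactly `a` times, by the numbers q * a + i with i < a. This is why
-- flooring a uniform variable yields a uniform one.
∑-quotients : ∀ a .{{_ : NonZero a}} m (f : ℕ → ℕ) →
              ∑ (upTo (m * a)) (λ x → f (x / a)) ≡ a * ∑ (upTo m) f
∑-quotients a m f = begin
  ∑ (upTo (m * a)) (λ x → f (x / a))                       ≡⟨ ∑-upTo-* m a (λ x → f (x / a)) ⟨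
  ∑ (upTo m) (λ q → ∑ (upTo a) λ i → f ((q * a + i) / a))
    ≡⟨ ∑-upTo-cong m (λ q _ → trans (∑-upTo-cong a λ i i<a → cong f (quot q i<a)) (∑-const (upTo a) (f q))) ⟩
  ∑ (upTo m) (λ q → length (upTo a) * f q)                 ≡⟨ ∑-*ˡ (length (upTo a)) (upTo m) f ⟩
  length (upTo a) * ∑ (upTo m) f                           ≡⟨ cong (_* ∑ (upTo m) f) (length-upTo a) ⟩
  a * ∑ (upTo m) f                                         ∎
  where
  open ≡-Reasoning
  quot : ∀ q {i} → i < a → (q * a + i) / a ≡ q
  quot q {i} i<a = begin
    (q * a + i) / a     ≡⟨ +-distrib-/-∣ˡ i (n∣m*n q) ⟩
    q * a / a + i / a   ≡⟨ cong₂ _+_ (m*n/n≡m q a) (m<n⇒m/n≡0 i<a) ⟩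
    q + 0               ≡⟨ +-identityʳ q ⟩
    q                   ∎

-- Quadratic inequalities in ℕ.

square-cancel-≤ : ∀ {a b} → a * a ≤ b * b → a ≤ b
square-cancel-≤ {a} {b} le with a ≤? b
... | yes a≤b = a≤b
... | no  a≰b = contradiction le (<⇒≱ (*-mono-< (≰⇒> a≰b) (≰⇒> a≰b)))

-- With the cross term moved to the left, the square of a difference becomes a polynomial free of
-- subtraction, which the ring solver can handle.
∣-∣²+2* : ∀ a b → ∣ a - b ∣ * ∣ a - b ∣ + 2 * (a * b) ≡ a * a + b * b
∣-∣²+2* a b with ≤-total a b
... | inj₁ a≤b with k , refl ← m≤n⇒∃[o]m+o≡n a≤b rewrite ∣m-m+n∣≡n a k = lem a k
  where
  lem : ∀ a k → k * k + 2 * (a * (a + k)) ≡ a * a + (a + k) * (a + k)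
  lem = solve-∀
... | inj₂ b≤a with k , refl ← m≤n⇒∃[o]m+o≡n b≤a rewrite ∣-∣-comm (b + k) b | ∣m-m+n∣≡n b k = lem b k
  where
  lem : ∀ b k → k * k + 2 * ((b + k) * b) ≡ (b + k) * (b + k) + b * b
  lem = solve-∀

2ab≤a²+b² : ∀ a b → 2 * (a * b) ≤ a * a + b * b
2ab≤a²+b² a b = subst (2 * (a * b) ≤_) (∣-∣²+2* a b) (m≤n+m _ (∣ a - b ∣ * ∣ a - b ∣))

cauchy-schwarz : ∀ (xs : List A) (f : A → ℕ) →
                 ∑ xs f * ∑ xs f ≤ length xs * ∑ xs (λ x → f x * f x)
cauchy-schwarz []       f = z≤n
cauchy-schwarz (x ∷ xs) f = begin
  (a + S) * (a + S)                    ≡⟨ expand a S ⟩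
  a * a + (2 * (a * S) + S * S)        ≤⟨ +-monoʳ-≤ (a * a) (+-mono-≤ (cross xs) (cauchy-schwarz xs f)) ⟩
  a * a + (length xs * (a * a) + Q + length xs * Q)
                                       ≡⟨ collect (a * a) Q (length xs) ⟩
  (1 + length xs) * (a * a + Q)        ∎
  where
  open ≤-Reasoning
  a S Q : ℕ
  a = f x
  S = ∑ xs f
  Q = ∑ xs λ y → f y * f y
  expand : ∀ a S → (a + S) * (a + S) ≡ a * a + (2 * (a * S) + S * S)
  expand = solve-∀
  collect : ∀ a Q l → a + (l * a + Q + l * Q) ≡ (1 + l) * (a + Q)
  collect = solve-∀
  cross : ∀ ys → 2 * (a * ∑ ys f) ≤ length ys * (a * a) + ∑ ys (λ y → f y * f y)
  cross ys = begin
    2 * (a * ∑ ys f)                    ≡⟨ *-assoc 2 a _ ⟨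
    2 * a * ∑ ys f                      ≡⟨ ∑-*ˡ (2 * a) ys f ⟨
    ∑ ys (λ y → 2 * a * f y)            ≤⟨ ∑-mono ys (λ y _ → ≤-trans (≤-reflexive (*-assoc 2 a (f y))) (2ab≤a²+b² a (f y))) ⟩
    ∑ ys (λ y → a * a + f y * f y)      ≡⟨ ∑-+ ys (λ _ → a * a) _ ⟩
    ∑ ys (λ _ → a * a) + ∑ ys (λ y → f y * f y)
                                        ≡⟨ cong (_+ ∑ ys (λ y → f y * f y)) (∑-const ys (a * a)) ⟩
    length ys * (a * a) + ∑ ys (λ y → f y * f y) ∎

-- Σ 1/√(t+1) ≤ 2√n, for a t ≤ √(J/(t+1)), with the roots squared away.
∑-inverse-sqrt : ∀ n (a : ℕ → ℕ) J → (∀ t → t < n → a t * a t * suc t ≤ J) →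
                 ∑ (upTo n) a * ∑ (upTo n) a ≤ 4 * J * n
∑-inverse-sqrt zero    a J le = z≤n
∑-inverse-sqrt (suc n) a J le rewrite ∑-upTo-suc n a = *-cancelʳ-≤ _ _ (suc n) (begin
  (S + x) * (S + x) * suc n                       ≡⟨ expand S x (suc n) ⟩
  S * S * suc n + (2 * (S * x * suc n) + x * x * suc n)
    ≤⟨ +-mono-≤ (*-monoˡ-≤ (suc n) IH) (+-mono-≤ cross (le n ≤-refl)) ⟩
  4 * J * n * suc n + (J * (4 * n + 3) + J)       ≡⟨ collect J n ⟩
  4 * J * suc n * suc n                           ∎)
  where
  open ≤-Reasoning
  S x : ℕ
  S = ∑ (upTo n) a
  x = a n
  IH : S * S ≤ 4 * J * n
  IH = ∑-inverse-sqrt n a J λ t t<n → le t (m<n⇒m<1+n t<n)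
  expand : ∀ S x m → (S + x) * (S + x) * m ≡ S * S * m + (2 * (S * x * m) + x * x * m)
  expand = solve-∀
  collect : ∀ J n → 4 * J * n * suc n + (J * (4 * n + 3) + J) ≡ 4 * J * suc n * suc n
  collect = solve-∀
  -- The budget 4n + 3 = 4(n + 1) - 1 is exactly what the induction step leaves. Its square exceeds
  -- 16n(n + 1) by 8n + 9, the slack added below.
  cross : 2 * (S * x * suc n) ≤ J * (4 * n + 3)
  cross = square-cancel-≤ (begin
    2 * (S * x * suc n) * (2 * (S * x * suc n))   ≡⟨ e₁ S x (suc n) ⟩
    4 * suc n * (S * S * (x * x * suc n))         ≤⟨ *-monoʳ-≤ (4 * suc n) (*-mono-≤ IH (le n ≤-refl)) ⟩
    4 * suc n * (4 * J * n * J)                   ≤⟨ m≤m+n _ (J * J * (8 * n + 9)) ⟩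
    4 * suc n * (4 * J * n * J) + J * J * (8 * n + 9) ≡⟨ e₂ J n ⟩
    J * (4 * n + 3) * (J * (4 * n + 3))           ∎)
    where
    e₁ : ∀ S x m → 2 * (S * x * m) * (2 * (S * x * m)) ≡ 4 * m * (S * S * (x * x * m))
    e₁ = solve-∀
    e₂ : ∀ J n → 4 * suc n * (4 * J * n * J) + J * J * (8 * n + 9) ≡ J * (4 * n + 3) * (J * (4 * n + 3))
    e₂ = solve-∀

-- Uniform insertion into a ranking and its potential.

-- punchIn on ℕ: the v-th natural number different from c.
pin : ℕ → ℕ → ℕ
pin zero    v       = suc v
pin (suc c) zero    = zero
pin (suc c) (suc v) = suc (pin c v)

pin-injective : ∀ c {v w} → pin c v ≡ pin c w → v ≡ w
pin-injective zero    {v}     {w}     eq = suc-injective eq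
pin-injective (suc c) {zero}  {zero}  eq = refl
pin-injective (suc c) {suc v} {suc w} eq = cong suc (pin-injective c (suc-injective eq))

pin≢ : ∀ c v → pin c v ≢ c
pin≢ (suc c) (suc v) eq = pin≢ c v (suc-injective eq)

pin-< : ∀ c {v m} → v < m → pin c v < suc m
pin-< zero            v<m       = s≤s v<m
pin-< (suc c) {zero}  v<m       = z<s
pin-< (suc c) {suc v} (s≤s v<m) = s≤s (pin-< c v<m)

pin-<ᵇ : ∀ c v w → (pin c v <ᵇ pin c w) ≡ (v <ᵇ w)
pin-<ᵇ zero    v       w       = refl
pin-<ᵇ (suc c) zero    zero    = refl
pin-<ᵇ (suc c) zero    (suc w) = refl
pin-<ᵇ (suc c) (suc v) zero    = refl
pin-<ᵇ (suc c) (suc v) (suc w) = pin-<ᵇ c v w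

pin-≤ : ∀ {c v} → c ≤ v → pin c v ≡ suc v
pin-≤ z≤n       = refl
pin-≤ (s≤s c≤v) = cong suc (pin-≤ c≤v)

pin-> : ∀ {c v} → v < c → pin c v ≡ v
pin-> {suc c} {zero}  _         = refl
pin-> {suc c} {suc v} (s≤s v<c) = cong suc (pin-> v<c)

-- Inserting at one of the v + 1 places c ≤ v pushes the item up by one; the other d places leave it
-- alone. This is the law of one insertion.
∑-pin : ∀ v d (f : ℕ → ℕ) →
        ∑ (upTo (suc v + d)) (λ c → f (pin c v)) ≡ suc v * f (suc v) + d * f v
∑-pin v d f = begin
  ∑ (upTo (suc v + d)) (λ c → f (pin c v))
    ≡⟨ ∑-upTo-+ (suc v) d (λ c → f (pin c v)) ⟩
  ∑ (upTo (suc v)) (λ c → f (pin c v)) + ∑ (upTo d) (λ i → f (pin (suc v + i) v))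
    ≡⟨ cong₂ _+_ (∑-upTo-cong (suc v) λ c c<1+v → cong f (pin-≤ (s≤s⁻¹ c<1+v)))
                 (∑-upTo-cong d λ i _ → cong f (pin-> (s≤s (m≤m+n v i)))) ⟩
  ∑ (upTo (suc v)) (λ _ → f (suc v)) + ∑ (upTo d) (λ _ → f v)
    ≡⟨ cong₂ _+_ (trans (∑-const (upTo (suc v)) _) (cong (_* f (suc v)) (length-upTo (suc v))))
                 (trans (∑-const (upTo d) _) (cong (_* f v) (length-upTo d))) ⟩
  suc v * f (suc v) + d * f v ∎
  where open ≡-Reasoning

potential : ℕ → ℕ → ℕ → ℕ → ℕ
potential α y M Y = ∣ α * Y - M * y ∣ * ∣ α * Y - M * y ∣ + α * α * Y

private
  main cross : ℕ → ℕ → ℕ → ℕ → ℕ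
  main  α y M Y = α * Y * (α * Y) + M * y * (M * y) + α * α * Y
  cross α y M Y = 2 * (α * Y * (M * y))

  potential+cross : ∀ α y M Y → potential α y M Y + cross α y M Y ≡ main α y M Y
  potential+cross α y M Y = trans (lem (∣ α * Y - M * y ∣ * ∣ α * Y - M * y ∣) (α * α * Y) (cross α y M Y))
                                  (cong (_+ α * α * Y) (∣-∣²+2* (α * Y) (M * y)))
    where
    lem : ∀ a b c → a + b + c ≡ a + c + b
    lem = solve-∀

potential-diag : ∀ α y → potential α y α y ≡ α * α * y
potential-diag α y = cong (λ k → k * k + α * α * y) (∣n-n∣≡0 (α * y))

-- Inserting a new item uniformly among M − 1 others, M ↦ M + 1, makes Y / M a martingale for the
-- 1-based rank Y = v + 1 of a fixed item; the summand α²Y of the potential pays for the variance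
-- of the increments.
potential-step : ∀ α y M v → v < M →
  M * ∑ (upTo M) (λ c → potential α y (suc M) (suc (pin c v)))
    ≤ suc M * suc M * potential α y M (suc v)
potential-step α y M v v<M with d , refl ← m≤n⇒∃[o]m+o≡n v<M =
  -- The cross term is linear in `Y`, so it satisfies the martingale property with equality and can
  -- be added to both sides. What remains is polynomial.
  +-cancelʳ-≤ (suc M * suc M * cross α y M Y) _ _ (begin
    M * ∑ (upTo M) (λ c → P (suc (pin c v))) + suc M * suc M * cross α y M Y
      ≡⟨ cong₂ (λ a b → M * a + b) (∑-pin v d (P ∘ suc)) (cross≡ α y v d) ⟩
    M * (Y * P (suc Y) + d * P Y) + M * (Y * K (suc Y) + d * K Y)
      ≡⟨ collect M Y d (P (suc Y)) (P Y) (K (suc Y)) (K Y) ⟩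
    M * (Y * (P (suc Y) + K (suc Y)) + d * (P Y + K Y))
      ≡⟨ cong₂ (λ a b → M * (Y * a + d * b)) (potential+cross α y (suc M) (suc Y)) (potential+cross α y (suc M) Y) ⟩
    M * (Y * G (suc Y) + d * G Y)
      -- The exact gap between the two sides; adding it turns the inequality into the identity
      -- `main≡`.
      ≤⟨ m≤m+n _ (α * α * (Y * suc Y)) ⟩
    M * (Y * G (suc Y) + d * G Y) + α * α * (Y * suc Y)
      ≡⟨ main≡ α y v d ⟩
    suc M * suc M * main α y M Y
      ≡⟨ cong (suc M * suc M *_) (potential+cross α y M Y) ⟨
    suc M * suc M * (potential α y M Y + cross α y M Y)
      ≡⟨ *-distribˡ-+ (suc M * suc M) (potential α y M Y) (cross α y M Y) ⟩
    suc M * suc M * potential α y M Y + suc M * suc M * cross α y M Y ∎)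
  where
  open ≤-Reasoning
  Y : ℕ
  Y = suc v
  P K G : ℕ → ℕ
  P = potential α y (suc M)
  K = cross α y (suc M)
  G = main α y (suc M)
  collect : ∀ M Y d p q k l → M * (Y * p + d * q) + M * (Y * k + d * l) ≡ M * (Y * (p + k) + d * (q + l))
  collect = solve-∀
  cross≡ : ∀ α y v d → let Y = suc v ; M = Y + d in
    suc M * suc M * (2 * (α * Y * (M * y)))
      ≡ M * (Y * (2 * (α * suc Y * (suc M * y))) + d * (2 * (α * Y * (suc M * y))))
  cross≡ = solve-∀
  main≡ : ∀ α y v d → let Y = suc v ; M = Y + d in
    M * (Y * (α * suc Y * (α * suc Y) + suc M * y * (suc M * y) + α * α * suc Y)
         + d * (α * Y * (α * Y) + suc M * y * (suc M * y) + α * α * Y)) + α * α * (Y * suc Y)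
      ≡ suc M * suc M * (α * Y * (α * Y) + M * y * (M * y) + α * α * Y)
  main≡ = solve-∀

-- The algorithm: relative ranks, quantiles, free slots and seeds.

relRank : (ℕ → ℕ → Bool) → ℕ → ℕ
relRank h s = ∑ (upTo s) λ j → 𝟙 (h j s)

𝟙≤1 : ∀ b → 𝟙 b ≤ 1
𝟙≤1 true  = ≤-refl
𝟙≤1 false = z≤n

relRank≤ : ∀ h s → relRank h s ≤ s
relRank≤ h s = subst (relRank h s ≤_) (trans (*-identityʳ _) (length-upTo s))
                 (∑-≤-length (upTo s) λ j _ → 𝟙≤1 (h j s))

relRank-cong : ∀ h k s → (∀ j → j < s → h j s ≡ k j s) → relRank h s ≡ relRank k s
relRank-cong h k s eq = ∑-upTo-cong s λ j j<s → cong 𝟙 (eq j j<s)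

-- n − s, the number of free slots at time s < n, in a form that is visibly nonzero.
room : ℕ → ℕ → ℕ
room n s = suc (n ∸ suc s)

room≡ : ∀ {n s} → s < n → room n s ≡ n ∸ s
room≡ s<n = sym (+-∸-assoc 1 s<n)

-- The pair (r, u) is uniform on [0, s] × [0, n−s), so r (n−s) + u is uniform on [0, (s+1)(n−s))
-- and its quotient by s+1 is uniform on [0, n−s).  The % only makes the bound unconditional.
quantile : ℕ → ℕ → ℕ → ℕ → ℕ
quantile n s r u = (r * room n s + u % room n s) / suc s

quantile< : ∀ n s {r} u → r ≤ s → quantile n s r u < room n s
quantile< n s {r} u r≤s = m<n*o⇒m/o<n (begin-strict
  r * room n s + u % room n s   <⟨ +-mono-≤-< (*-monoˡ-≤ (room n s) r≤s) (m%n<n u (room n s)) ⟩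
  s * room n s + room n s       ≡⟨ +-comm (s * room n s) _ ⟩
  suc s * room n s              ≡⟨ *-comm (suc s) (room n s) ⟩
  room n s * suc s              ∎)
  where open ≤-Reasoning

-- Translates an index among the slots free at time `s` into an absolute slot. Each `pin (c s)`
-- passes from the slots free after round `s` to those free before it.
unroll : (ℕ → ℕ) → ℕ → ℕ → ℕ
unroll c zero    v = v
unroll c (suc s) v = unroll c s (pin (c s) v)

-- The c t-th (from 0) of the slots not taken by slot c 0, …, slot c (t − 1).
slot : (ℕ → ℕ) → ℕ → ℕ
slot c t = unroll c t (c t)

unroll-cong : ∀ {c d} s v → (∀ i → i < s → c i ≡ d i) → unroll c s v ≡ unroll d s v
unroll-cong zero    v eq = refl
unroll-cong {c} {d} (suc s) v eq rewrite eq s ≤-refl =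
  unroll-cong s (pin (d s) v) λ i i<s → eq i (m<n⇒m<1+n i<s)

slot-cong : ∀ {c d} t → (∀ i → i ≤ t → c i ≡ d i) → slot c t ≡ slot d t
slot-cong {c} {d} t eq rewrite eq t ≤-refl = unroll-cong t (d t) λ i i<t → eq i (<⇒≤ i<t)

unroll-injective : ∀ c s {v w} → unroll c s v ≡ unroll c s w → v ≡ w
unroll-injective c zero    eq = eq
unroll-injective c (suc s) eq = pin-injective (c s) (unroll-injective c s eq)

unroll< : ∀ {c n} s {v} → s ≤ n → v < n ∸ s → unroll c s v < n
unroll<         zero        s≤n v< = v<
unroll< {c} {n} (suc s) {v} s<n v< =
  unroll< s (<⇒≤ s<n) (subst (pin (c s) v <_) (room≡ s<n) (pin-< (c s) v<))

-- When the unrolling reaches round `t`, `pin (c t)` misses `c t`, and the remaining unrolling is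
-- injective.
unroll-avoids : ∀ c {t s} v → t < s → unroll c s v ≢ slot c t
unroll-avoids c {t} {suc s} v (s≤s t≤s) eq with m≤n⇒m<n∨m≡n t≤s
... | inj₁ t<s  = unroll-avoids c (pin (c s) v) t<s eq
... | inj₂ refl = pin≢ (c s) v (unroll-injective c s eq)

slot-injective : ∀ c t s → slot c t ≡ slot c s → t ≡ s
slot-injective c t s eq with <-cmp t s
... | tri< t<s _ _ = contradiction (sym eq) (unroll-avoids c (c s) t<s)
... | tri≈ _ t≡s _ = t≡s
... | tri> _ _ s<t = contradiction eq (unroll-avoids c (c t) s<t)

update : (ℕ → ℕ) → ℕ → ℕ → ℕ → ℕ
update f s u i = if i ≡ᵇ s then u else f i

update-≡ : ∀ f s u → update f s u s ≡ u
update-≡ f s u with s ≡ᵇ s | ≡⇒≡ᵇ s s refl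
... | true | _ = refl

update-< : ∀ f {s} u {i} → i < s → update f s u i ≡ f i
update-< f {s} u {i} i<s with i ≡ᵇ s in eq
... | false = refl
... | true  = contradiction (≡ᵇ⇒≡ i s (subst T (sym eq) _)) (<⇒≢ i<s)

-- The product of the ranges [0, n - i) for i < s, as a list of functions. A new round only
-- overwrites its own argument, so averages can be taken one round at a time and earlier choices
-- persist.
seedFunctions : ℕ → ℕ → List (ℕ → ℕ)
seedFunctions n zero    = [ (λ _ → 0) ]
seedFunctions n (suc s) = cartesianProductWith (λ f u → update f s u) (seedFunctions n s) (upTo (room n s))

length-cartesianProductWith : ∀ (h : A → B → C) xs ys →
  length (cartesianProductWith h xs ys) ≡ length xs * length ys
length-cartesianProductWith h []       ys = refl
length-cartesianProductWith h (x ∷ xs) ys =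
  trans (length-++ (map (h x) ys)) (cong₂ _+_ (length-map (h x) ys) (length-cartesianProductWith h xs ys))

seedFunctions-suc : ∀ n s → length (seedFunctions n (suc s)) ≡ length (seedFunctions n s) * room n s
seedFunctions-suc n s = trans (length-cartesianProductWith _ (seedFunctions n s) _)
                              (cong (length (seedFunctions n s) *_) (length-upTo (room n s)))

seedFunctions≢0 : ∀ n s → NonZero (length (seedFunctions n s))
seedFunctions≢0 n zero    = _
seedFunctions≢0 n (suc s) = subst NonZero (sym (seedFunctions-suc n s))
  (m*n≢0 _ _ {{seedFunctions≢0 n s}})

-- The default `false` is never read: the slot at time t depends only on comparisons among times up
-- to t.
extend : ∀ {m} → (Fin m → Fin m → Bool) → ℕ → ℕ → Bool
extend {m} h i j with i <? m | j <? m
... | yes i<m | yes j<m = h (fromℕ< i<m) (fromℕ< j<m)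
... | _       | _       = false

choices : ℕ → (ℕ → ℕ → Bool) → (ℕ → ℕ) → ℕ → ℕ
choices n h u s = quantile n s (relRank h s) (u s)

choices-cong : ∀ n h k u s → (∀ j → j < s → h j s ≡ k j s) → choices n h u s ≡ choices n k u s
choices-cong n h k u s eq = cong (λ r → quantile n s r (u s)) (relRank-cong h k s eq)

choices< : ∀ n h u s → choices n h u s < room n s
choices< n h u s = quantile< n s (u s) (relRank≤ h s)

slot< : ∀ {n t} h u → t < n → slot (choices n h u) t < n
slot< {n} {t} h u t<n = unroll< t (<⇒≤ t<n) (subst (choices n h u t <_) (room≡ t<n) (choices< n h u t))

quantileAlgorithm : Algorithm
quantileAlgorithm = record
  { seeds   = λ n → length (seedFunctions n n)
  ; seeds≢0 = λ n → seedFunctions≢0 n n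
  ; place   = λ n s t h → fromℕ< (slot< (extend h) (List.lookup (seedFunctions n n) s) (toℕ<n t))
  }

-- Arrival orders on ℕ and validity of the algorithm.

at : ∀ {n k} → Vec (Fin n) k → ℕ → ℕ
at []       _       = 0
at (x ∷ xs) zero    = toℕ x
at (x ∷ xs) (suc i) = at xs i

at-lookup : ∀ {n k} (σ : Vec (Fin n) k) i → toℕ (lookup σ i) ≡ at σ (toℕ i)
at-lookup (x ∷ σ) Fin.zero    = refl
at-lookup (x ∷ σ) (Fin.suc i) = at-lookup σ i

order : ∀ {n k} → Vec (Fin n) k → ℕ → ℕ → Bool
order σ i j = at σ i <ᵇ at σ j

extend-history : ∀ {n} (σ : Vec (Fin n) n) t {i j} → i ≤ toℕ t → j ≤ toℕ t →
                 extend (history σ t) i j ≡ order σ i j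
extend-history σ t {i} {j} i≤t j≤t with i <? suc (toℕ t) | j <? suc (toℕ t)
... | yes i< | yes j< = cong₂ _<ᵇ_ (at-embed i<) (at-embed j<)
  where
  at-embed : ∀ {i} (i< : i < suc (toℕ t)) → toℕ (lookup σ (embed t (fromℕ< i<))) ≡ at σ i
  at-embed i< = trans (at-lookup σ _)
    (cong (at σ) (trans (toℕ-inject≤ (fromℕ< i<) (toℕ<n t)) (toℕ-fromℕ< i<)))
... | no i≮  | _      = contradiction (s≤s i≤t) i≮
... | yes _  | no j≮  = contradiction (s≤s j≤t) j≮

-- Replaces the histories, which differ from time to time, by one choice function for the whole run.
-- Validity then reduces to `slot-injective`, and the analysis may ignore the online restriction.
toℕ-position : ∀ n s (σ : Vec (Fin n) n) t →
  toℕ (position quantileAlgorithm n s σ t)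
    ≡ slot (choices n (order σ) (List.lookup (seedFunctions n n) s)) (toℕ t)
toℕ-position n s σ t = trans (toℕ-fromℕ< _) (slot-cong (toℕ t) λ i i≤t →
  choices-cong n (extend (history σ t)) (order σ) (List.lookup (seedFunctions n n) s) i λ j j<i → extend-history σ t (≤-trans (<⇒≤ j<i) i≤t) i≤t)

quantileAlgorithm-valid : Valid quantileAlgorithm
quantileAlgorithm-valid n s σ _ t u eq = toℕ-injective (slot-injective _ _ _
  (trans (sym (toℕ-position n s σ t)) (trans (cong toℕ eq) (toℕ-position n s σ u))))

-- Permutations enumerated by their relative ranks.

toℕ-punchIn : ∀ {n} (r : Fin (suc n)) j → toℕ (punchIn r j) ≡ pin (toℕ r) (toℕ j)
toℕ-punchIn Fin.zero    j           = refl
toℕ-punchIn (Fin.suc r) Fin.zero    = refl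
toℕ-punchIn (Fin.suc r) (Fin.suc j) = cong suc (toℕ-punchIn r j)

pin-<ᵇ-below : ∀ {k q} a → k ≤ q → (pin q a <ᵇ k) ≡ (a <ᵇ k)
pin-<ᵇ-below                 a       z≤n       = refl
pin-<ᵇ-below                 zero    (s≤s k≤q) = refl
pin-<ᵇ-below                 (suc a) (s≤s k≤q) = pin-<ᵇ-below a k≤q

pin-<ᵇ-above : ∀ {k q} a → q ≤ k → (pin q a <ᵇ suc k) ≡ (a <ᵇ k)
pin-<ᵇ-above a       z≤n       = refl
pin-<ᵇ-above zero    (s≤s q≤k) = refl
pin-<ᵇ-above (suc a) (s≤s q≤k) = pin-<ᵇ-above a q≤k

-- The arrival order in which the first n elements compare as in σ and the last one has rank r.
insertLast : ∀ {n} → Vec (Fin n) n → Fin (suc n) → Vec (Fin (suc n)) (suc n)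
insertLast σ r = Vec.map (punchIn r) σ ∷ʳ r

-- In this enumeration the last relative rank is a separate uniform factor, which is the
-- independence of relative ranks. `isPerm-↭-perms` reconciles it with the filtered list of all
-- vectors.
perms : ∀ n → List (Vec (Fin n) n)
perms zero    = [ [] ]
perms (suc n) = cartesianProductWith insertLast (perms n) (allFin (suc n))

perms-suc : ∀ n → length (perms (suc n)) ≡ length (perms n) * suc n
perms-suc n = trans (length-cartesianProductWith insertLast (perms n) _)
                    (cong (length (perms n) *_) (length-tabulate {n = suc n} id))

at-map-∷ʳ-< : ∀ {n k} (r : Fin (suc n)) (v : Vec (Fin n) k) x {i} → i < k →
              at (Vec.map (punchIn r) v ∷ʳ x) i ≡ pin (toℕ r) (at v i)
at-map-∷ʳ-< r (y ∷ v) x {zero}  _         = toℕ-punchIn r y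
at-map-∷ʳ-< r (y ∷ v) x {suc i} (s≤s i<k) = at-map-∷ʳ-< r v x i<k

at-∷ʳ-≡ : ∀ {n k} (v : Vec (Fin n) k) x → at (v ∷ʳ x) k ≡ toℕ x
at-∷ʳ-≡ []      x = refl
at-∷ʳ-≡ (y ∷ v) x = at-∷ʳ-≡ v x

at-∷ʳ-< : ∀ {n k} (v : Vec (Fin n) k) x {i} → i < k → at (v ∷ʳ x) i ≡ at v i
at-∷ʳ-< (y ∷ v) x {zero}  _         = refl
at-∷ʳ-< (y ∷ v) x {suc i} (s≤s i<k) = at-∷ʳ-< v x i<k

at-insertLast-< : ∀ {n} (σ : Vec (Fin n) n) r {i} → i < n →
                  at (insertLast σ r) i ≡ pin (toℕ r) (at σ i)
at-insertLast-< σ r = at-map-∷ʳ-< r σ r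

at-insertLast-≡ : ∀ {n} (σ : Vec (Fin n) n) r → at (insertLast σ r) n ≡ toℕ r
at-insertLast-≡ σ r = at-∷ʳ-≡ (Vec.map (punchIn r) σ) r

at< : ∀ {n k} (v : Vec (Fin n) k) {i} → i < k → at v i < n
at< (x ∷ v) {zero}  _         = toℕ<n x
at< (x ∷ v) {suc i} (s≤s i<k) = at< v i<k

order-insertLast : ∀ {n} (σ : Vec (Fin n) n) r {i j} → i < n → j < n →
                   order (insertLast σ r) i j ≡ order σ i j
order-insertLast σ r {i} {j} i<n j<n =
  trans (cong₂ _<ᵇ_ (at-insertLast-< σ r i<n) (at-insertLast-< σ r j<n)) (pin-<ᵇ (toℕ r) (at σ i) (at σ j))

-- Induction on the last insertion at q. If k ≤ q, the last entry is not counted and the threshold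
-- for the rest stays k; otherwise it is counted and the threshold drops by one.
perms-count-below : ∀ n {σ} → σ ∈ perms n → ∀ k → k ≤ n → ∑ (upTo n) (λ j → 𝟙 (at σ j <ᵇ k)) ≡ k
perms-count-below zero    _  zero z≤n = refl
perms-count-below (suc n) σ∈ k    k≤
  with τ , q , τ∈ , _ , refl ← ∈-cartesianProductWith⁻ insertLast (perms n) (allFin (suc n)) σ∈
  = trans (∑-upTo-suc n _) (trans
      (cong₂ _+_ (∑-upTo-cong n λ j j<n → cong (λ a → 𝟙 (a <ᵇ k)) (at-insertLast-< τ q j<n))
                 (cong (λ a → 𝟙 (a <ᵇ k)) (at-insertLast-≡ τ q)))
      (split k k≤))
  where
  split : ∀ k → k ≤ suc n → ∑ (upTo n) (λ j → 𝟙 (pin (toℕ q) (at τ j) <ᵇ k)) + 𝟙 (toℕ q <ᵇ k) ≡ k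
  split k k≤ with k ≤? toℕ q
  split k k≤ | yes k≤q with toℕ q <ᵇ k in eq
  ... | true  = contradiction (<ᵇ⇒< _ _ (subst T (sym eq) _)) (≤⇒≯ k≤q)
  ... | false = trans (+-identityʳ _) (trans
    (∑-upTo-cong n λ j _ → cong 𝟙 (pin-<ᵇ-below (at τ j) k≤q))
    (perms-count-below n τ∈ k (≤-trans k≤q (s≤s⁻¹ (toℕ<n q)))))
  split zero k≤ | no k≰q = contradiction z≤n k≰q
  split (suc k) (s≤s k≤) | no k≰q with toℕ q <ᵇ suc k in eq
  ... | false = contradiction (<⇒<ᵇ (≰⇒> k≰q)) (subst (¬_ ∘ T) (sym eq) id)
  ... | true  = trans (+-comm _ 1) (cong suc (trans
    (∑-upTo-cong n λ j _ → cong 𝟙 (pin-<ᵇ-above (at τ j) (s≤s⁻¹ (≰⇒> k≰q))))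
    (perms-count-below n τ∈ k k≤)))

relRank-insertLast-≡ : ∀ {n σ} → σ ∈ perms n → ∀ r → relRank (order (insertLast σ r)) n ≡ toℕ r
relRank-insertLast-≡ {n} {σ} σ∈ r = trans
  (∑-upTo-cong n λ j j<n → cong 𝟙 (trans
    (cong₂ _<ᵇ_ (at-insertLast-< σ r j<n) (at-insertLast-≡ σ r))
    (pin-<ᵇ-below (at σ j) (≤-refl {toℕ r}))))
  (perms-count-below n σ∈ (toℕ r) (s≤s⁻¹ (toℕ<n r)))

relRank-insertLast-< : ∀ {n} (σ : Vec (Fin n) n) r {s} → s < n →
                       relRank (order (insertLast σ r)) s ≡ relRank (order σ) s
relRank-insertLast-< σ r {s} s<n = relRank-cong (order (insertLast σ r)) (order σ) s λ j j<s →
  order-insertLast σ r (<-trans j<s s<n) s<n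

InjectiveAt : ∀ {n k} → Vec (Fin n) k → Set
InjectiveAt {k = k} v = ∀ {i j} → i < k → j < k → at v i ≡ at v j → i ≡ j

any⁺ : ∀ {n k} (x : Fin n) (v : Vec (Fin n) k) {j} → j < k → toℕ x ≡ at v j →
       T (any (λ y → ⌊ x ≟F y ⌋) (toList v))
any⁺ x (y ∷ v) j<k       eq with x ≟F y
any⁺ x (y ∷ v) j<k       eq | yes _ = _
any⁺ x (y ∷ v) {zero}  j<k       eq | no x≢y = contradiction (toℕ-injective eq) x≢y
any⁺ x (y ∷ v) {suc j} (s≤s j<k) eq | no x≢y = any⁺ x v j<k eq

any⁻ : ∀ {n k} (x : Fin n) (v : Vec (Fin n) k) → T (any (λ y → ⌊ x ≟F y ⌋) (toList v)) →
       ∃ λ j → j < k × toℕ x ≡ at v j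
any⁻ x (y ∷ v) p with x ≟F y
... | yes x≡y = 0 , z<s , cong toℕ x≡y
... | no  _   = let j , j<k , eq = any⁻ x v p in suc j , s≤s j<k , eq

T-not⁻ : ∀ {b} → T (not b) → ¬ T b
T-not⁻ {false} _ ()

T-not⁺ : ∀ {b} → ¬ T b → T (not b)
T-not⁺ {false} _  = _
T-not⁺ {true}  ¬t = ¬t _

distinct⇒InjectiveAt : ∀ {n k} (v : Vec (Fin n) k) → T (distinct (toList v)) → InjectiveAt v
distinct⇒InjectiveAt (x ∷ v) d {zero}  {zero}  _         _         eq = refl
distinct⇒InjectiveAt (x ∷ v) d {zero}  {suc j} _         (s≤s j<k) eq =
  contradiction (any⁺ x v j<k eq) (T-not⁻ (proj₁ (Equivalence.to T-∧ d)))
distinct⇒InjectiveAt (x ∷ v) d {suc i} {zero}  (s≤s i<k) _         eq =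
  contradiction (any⁺ x v i<k (sym eq)) (T-not⁻ (proj₁ (Equivalence.to T-∧ d)))
distinct⇒InjectiveAt (x ∷ v) d {suc i} {suc j} (s≤s i<k) (s≤s j<k) eq =
  cong suc (distinct⇒InjectiveAt v (proj₂ (Equivalence.to (T-∧ {not (any _ (toList v))}) d)) i<k j<k eq)

InjectiveAt⇒distinct : ∀ {n k} (v : Vec (Fin n) k) → InjectiveAt v → T (distinct (toList v))
InjectiveAt⇒distinct []      inj = _
InjectiveAt⇒distinct (x ∷ v) inj = Equivalence.from T-∧
  ( T-not⁺ (λ p → let j , j<k , eq = any⁻ x v p in 0≢1+n (inj z<s (s≤s j<k) eq))
  , InjectiveAt⇒distinct v λ i<k j<k eq → suc-injective (inj (s≤s i<k) (s≤s j<k) eq))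

InjectiveAt-insertLast : ∀ {n} (σ : Vec (Fin n) n) r → InjectiveAt σ → InjectiveAt (insertLast σ r)
InjectiveAt-insertLast {n} σ r inj {i} {j} i< j< eq with m≤n⇒m<n∨m≡n (s≤s⁻¹ i<) | m≤n⇒m<n∨m≡n (s≤s⁻¹ j<)
... | inj₁ i<n  | inj₁ j<n  = inj i<n j<n (pin-injective (toℕ r)
  (trans (sym (at-insertLast-< σ r i<n)) (trans eq (at-insertLast-< σ r j<n))))
... | inj₁ i<n  | inj₂ refl = contradiction
  (trans (sym (at-insertLast-< σ r i<n)) (trans eq (at-insertLast-≡ σ r))) (pin≢ (toℕ r) (at σ i))
... | inj₂ refl | inj₁ j<n  = contradiction
  (trans (sym (at-insertLast-< σ r j<n)) (trans (sym eq) (at-insertLast-≡ σ r))) (pin≢ (toℕ r) (at σ j))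
... | inj₂ refl | inj₂ refl = refl

∈-perms⇒InjectiveAt : ∀ n {σ} → σ ∈ perms n → InjectiveAt σ
∈-perms⇒InjectiveAt zero    _ ()
∈-perms⇒InjectiveAt (suc n) σ∈
  with τ , q , τ∈ , _ , refl ← ∈-cartesianProductWith⁻ insertLast (perms n) (allFin (suc n)) σ∈
  = InjectiveAt-insertLast τ q (∈-perms⇒InjectiveAt n τ∈)

punchOut-all : ∀ {n k} (r : Fin (suc n)) (v : Vec (Fin (suc n)) k) → (∀ {i} → i < k → at v i ≢ toℕ r) →
               ∃ λ w → Vec.map (punchIn r) w ≡ v
punchOut-all r []      avoid = [] , refl
punchOut-all r (x ∷ v) avoid =
  let w , eq = punchOut-all r v (λ i<k → avoid (s≤s i<k))
      r≢x    = λ r≡x → avoid z<s (cong toℕ (sym r≡x))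
  in punchOut r≢x ∷ w , cong₂ _∷_ (punchIn-punchOut r≢x) eq

-- The entries before the last one avoid it, so `punchOut` recovers the shorter order from which the
-- insertion started.
InjectiveAt⇒∈-perms : ∀ n (σ : Vec (Fin n) n) → InjectiveAt σ → σ ∈ perms n
InjectiveAt⇒∈-perms zero    []  inj = here refl
InjectiveAt⇒∈-perms (suc n) σ   inj with v , r , refl ← initLast σ
  with w , refl ← punchOut-all r v (λ i<n eq → <⇒≢ i<n
    (inj (m<n⇒m<1+n i<n) ≤-refl (trans (at-∷ʳ-< v r i<n) (trans eq (sym (at-∷ʳ-≡ v r))))))
  = ∈-cartesianProductWith⁺ insertLast (InjectiveAt⇒∈-perms n w λ i<n j<n eq →
      inj (m<n⇒m<1+n i<n) (m<n⇒m<1+n j<n)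
        (trans (at-insertLast-< w r i<n) (trans (cong (pin (toℕ r)) eq) (sym (at-insertLast-< w r j<n)))))
    (∈-allFin r)

map-injective : ∀ {A B : Set} {k} {f : A → B} → (∀ x y → f x ≡ f y → x ≡ y) →
                (v w : Vec A k) → Vec.map f v ≡ Vec.map f w → v ≡ w
map-injective inj []      []      eq = refl
map-injective inj (x ∷ v) (y ∷ w) eq =
  let eq₁ , eq₂ = ∷-injective eq in cong₂ _∷_ (inj x y eq₁) (map-injective inj v w eq₂)

perms-unique : ∀ n → Unique (perms n)
perms-unique zero    = []ᴬ ∷ᴾ []ᴾ
perms-unique (suc n) = cartesianProductWith⁺ insertLast insertLast-injective (perms-unique n) (allFin⁺ (suc n))
  where
  insertLast-injective : ∀ {σ τ q r} → insertLast σ q ≡ insertLast τ r → σ ≡ τ × q ≡ r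
  insertLast-injective {σ} {τ} {q} eq with ∷ʳ-injective (Vec.map (punchIn q) σ) _ eq
  ... | eq′ , refl = map-injective (punchIn-injective q) σ τ eq′ , refl

allVecs-suc : ∀ n k → allVecs n (suc k) ≡ cartesianProductWith (λ v x → x ∷ v) (allVecs n k) (allFin n)
allVecs-suc n k = go (allVecs n k)
  where
  go : ∀ vs → concatMap (λ v → map (_∷ v) (allFin n)) vs ≡ cartesianProductWith (λ v x → x ∷ v) vs (allFin n)
  go []       = refl
  go (v ∷ vs) = cong (map (_∷ v) (allFin n) ++_) (go vs)

allVecs-unique : ∀ n k → Unique (allVecs n k)
allVecs-unique n zero    = []ᴬ ∷ᴾ []ᴾ
allVecs-unique n (suc k) rewrite allVecs-suc n k =
  cartesianProductWith⁺ _ (λ eq → let p , q = ∷-injective eq in q , p) (allVecs-unique n k) (allFin⁺ n)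

∈-allVecs : ∀ {n k} (v : Vec (Fin n) k) → v ∈ allVecs n k
∈-allVecs []                        = here refl
∈-allVecs {n} {suc k} (x ∷ v) rewrite allVecs-suc n k =
  ∈-cartesianProductWith⁺ (λ v x → x ∷ v) (∈-allVecs v) (∈-allFin x)

-- Both lists are free of duplicates and have the same members, so no counting of permutations is
-- required.
isPerm-↭-perms : ∀ n → filterᵇ isPerm (allVecs n n) ↭ perms n
isPerm-↭-perms n = ∼bag⇒↭ (unique∧set⇒bag
  (filter⁺ (T? ∘ isPerm) (allVecs-unique n n)) (perms-unique n)
  (λ {σ} → mk⇔
    (λ σ∈ → InjectiveAt⇒∈-perms n σ (distinct⇒InjectiveAt σ (proj₂ (∈-filter⁻ (T? ∘ isPerm) {xs = allVecs n n} σ∈))))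
    (λ σ∈ → ∈-filter⁺ (T? ∘ isPerm) (∈-allVecs σ) (InjectiveAt⇒distinct σ (∈-perms⇒InjectiveAt n σ∈)))))

∑-if : ∀ {A : Set} (p : A → Bool) xs (f : A → ℕ) → ∑ xs (λ x → if p x then f x else 0) ≡ ∑ (filterᵇ p xs) f
∑-if p []       f = refl
∑-if p (x ∷ xs) f with p x
... | true  = cong (f x +_) (∑-if p xs f)
... | false = ∑-if p xs f

∑-isPerm : ∀ n (f : Vec (Fin n) n → ℕ) → ∑ (allVecs n n) (λ σ → if isPerm σ then f σ else 0) ≡ ∑ (perms n) f
∑-isPerm n f = trans (∑-if isPerm (allVecs n n) f) (sum-↭ (map⁺ f (isPerm-↭-perms n)))

-- Inversions against total displacement.

𝟙≤ : ∀ b {k} → (T b → 1 ≤ k) → 𝟙 b ≤ k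
𝟙≤ true  le = le _
𝟙≤ false le = z≤n

𝟙≥1 : ∀ b → T b → 1 ≤ 𝟙 b
𝟙≥1 true _ = ≤-refl

𝟙-∨ : ∀ a b → 𝟙 (a ∨ b) ≤ 𝟙 a + 𝟙 b
𝟙-∨ true  b = s≤s z≤n
𝟙-∨ false b = ≤-refl

InjectiveBelow : ℕ → (ℕ → ℕ) → Set
InjectiveBelow n x = ∀ {i j} → i < n → j < n → x i ≡ x j → i ≡ j

count-value : ∀ n x v → InjectiveBelow n x → ∑ (upTo n) (λ i → 𝟙 (x i ≡ᵇ v)) ≤ 1
count-value zero    x v inj = z≤n
count-value (suc n) x v inj rewrite ∑-upTo-suc n (λ i → 𝟙 (x i ≡ᵇ v)) with x n ≡ᵇ v in eq
... | false = subst (_≤ 1) (sym (+-identityʳ _))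
                (count-value n x v λ i<n j<n → inj (m<n⇒m<1+n i<n) (m<n⇒m<1+n j<n))
... | true  = +-monoˡ-≤ 1 (≤-trans (∑-upTo-mono n {g = λ _ → 0} λ i i<n → 𝟙≤ (x i ≡ᵇ v) λ xi≡v →
    contradiction (inj (m<n⇒m<1+n i<n) ≤-refl
      (trans (≡ᵇ⇒≡ (x i) v xi≡v) (sym (≡ᵇ⇒≡ (x n) v (subst T (sym eq) _))))) (<⇒≢ i<n))
  (≤-reflexive (trans (∑-const (upTo n) 0) (*-zeroʳ (length (upTo n))))))

between : ℕ → ℕ → ℕ → Bool
between a x b = (a <ᵇ x) ∧ (x ≤ᵇ b)

between⁻ : ∀ a x b → T (between a x b) → a < x × x ≤ b
between⁻ a x b t = let p , q = Equivalence.to (T-∧ {a <ᵇ x}) t in <ᵇ⇒< a x p , ≤ᵇ⇒≤ x b q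

between⁺ : ∀ {a x b} → a < x → x ≤ b → 1 ≤ 𝟙 (between a x b)
between⁺ a<x x≤b = 𝟙≥1 _ (Equivalence.from T-∧ (<⇒<ᵇ a<x , ≤⇒≤ᵇ x≤b))

-- Induction on `b`: the value b + 1 is taken by at most one index.
count-between : ∀ n x a b → InjectiveBelow n x → ∑ (upTo n) (λ i → 𝟙 (between a (x i) b)) ≤ b ∸ a
count-between n x a b inj with b ≤? a
... | yes b≤a = ≤-trans (∑-upTo-mono n {g = λ _ → 0} λ i _ → 𝟙≤ (between a (x i) b) λ t →
      let a<x , x≤b = between⁻ a (x i) b t in contradiction (≤-trans x≤b b≤a) (<⇒≱ a<x))
    (≤-trans (≤-reflexive (trans (∑-const (upTo n) 0) (*-zeroʳ (length (upTo n))))) z≤n)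
count-between n x a zero inj | no b≰a = contradiction z≤n b≰a
count-between n x a (suc b) inj | no b≰a = begin
  ∑ (upTo n) (λ i → 𝟙 (between a (x i) (suc b)))
    ≤⟨ ∑-upTo-mono n (λ i _ → 𝟙≤ (between a (x i) (suc b)) (split i)) ⟩
  ∑ (upTo n) (λ i → 𝟙 (between a (x i) b) + 𝟙 (x i ≡ᵇ suc b))
    ≡⟨ ∑-+ (upTo n) _ _ ⟩
  ∑ (upTo n) (λ i → 𝟙 (between a (x i) b)) + ∑ (upTo n) (λ i → 𝟙 (x i ≡ᵇ suc b))
    ≤⟨ +-mono-≤ (count-between n x a b inj) (count-value n x (suc b) inj) ⟩
  b ∸ a + 1      ≡⟨ +-comm (b ∸ a) 1 ⟩
  suc (b ∸ a)    ≡⟨ +-∸-assoc 1 (s≤s⁻¹ (≰⇒> b≰a)) ⟨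
  suc b ∸ a      ∎
  where
  open ≤-Reasoning
  split : ∀ i → T (between a (x i) (suc b)) → 1 ≤ 𝟙 (between a (x i) b) + 𝟙 (x i ≡ᵇ suc b)
  split i t with a<x , x≤1+b ← between⁻ a (x i) (suc b) t with m≤n⇒m<n∨m≡n x≤1+b
  ... | inj₁ x<1+b = ≤-trans (between⁺ a<x (s≤s⁻¹ x<1+b)) (m≤m+n _ _)
  ... | inj₂ x≡1+b = ≤-trans (𝟙≥1 _ (≡⇒≡ᵇ (x i) (suc b) x≡1+b)) (m≤n+m _ (𝟙 (between a (x i) b)))

-- For y i < y j and x j < x i, either x i ∈ (x j , y j] or y j ∈ (y i , x i].
inversions≤footrule : ∀ n x y (pos rk : Fin n → Fin n) →
  (∀ t → toℕ (rk t) ≡ x (toℕ t)) → (∀ t → toℕ (pos t) ≡ y (toℕ t)) →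
  InjectiveBelow n x → InjectiveBelow n y →
  inversions n pos rk ≤ 4 * ∑ (upTo n) (λ t → ∣ x t - y t ∣)
inversions≤footrule n x y pos rk rk≡ pos≡ x-inj y-inj = begin
  inversions n pos rk
    ≡⟨ ∑-cong (allFin n) (λ i _ → trans
         (∑-cong (allFin n) λ j _ → cong 𝟙 (cong₂ _∨_ (cong₂ _∧_ (cong₂ _<ᵇ_ (pos≡ i) (pos≡ j)) (cong₂ _<ᵇ_ (rk≡ j) (rk≡ i)))
                                                     (cong₂ _∧_ (cong₂ _<ᵇ_ (pos≡ j) (pos≡ i)) (cong₂ _<ᵇ_ (rk≡ i) (rk≡ j)))))
         (∑-allFin n (λ j → 𝟙 (inv (toℕ i) j ∨ inv j (toℕ i))))) ⟩
  ∑ (allFin n) (λ i → ∑ (upTo n) λ j → 𝟙 (inv (toℕ i) j ∨ inv j (toℕ i)))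
    ≡⟨ ∑-allFin n (λ i → ∑ (upTo n) λ j → 𝟙 (inv i j ∨ inv j i)) ⟩
  ∑ (upTo n) (λ i → ∑ (upTo n) λ j → 𝟙 (inv i j ∨ inv j i))
    ≤⟨ ∑-upTo-mono n (λ i _ → ≤-trans (∑-upTo-mono n λ j _ → 𝟙-∨ (inv i j) (inv j i)) (≤-reflexive (∑-+ (upTo n) _ _))) ⟩
  ∑ (upTo n) (λ i → ∑ (upTo n) (λ j → 𝟙 (inv i j)) + ∑ (upTo n) (λ j → 𝟙 (inv j i)))
    ≡⟨ ∑-+ (upTo n) _ _ ⟩
  I + ∑ (upTo n) (λ i → ∑ (upTo n) (λ j → 𝟙 (inv j i)))
    ≡⟨ cong (I +_) (∑-swap (upTo n) (upTo n) (λ i j → 𝟙 (inv j i))) ⟩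
  I + I
    ≤⟨ +-mono-≤ I≤ I≤ ⟩
  F + F + (F + F)
    ≡⟨ lem F ⟩
  4 * F ∎
  where
  open ≤-Reasoning
  inv : ℕ → ℕ → Bool
  inv i j = (y i <ᵇ y j) ∧ (x j <ᵇ x i)
  I F : ℕ
  I = ∑ (upTo n) λ i → ∑ (upTo n) λ j → 𝟙 (inv i j)
  F = ∑ (upTo n) λ t → ∣ x t - y t ∣
  lem : ∀ F → F + F + (F + F) ≡ 4 * F
  lem = solve-∀
  charge : ∀ i j → T (inv i j) → 1 ≤ 𝟙 (between (x j) (x i) (y j)) + 𝟙 (between (y i) (y j) (x i))
  charge i j t with p , q ← Equivalence.to (T-∧ {y i <ᵇ y j}) t with x i ≤? y j
  ... | yes xi≤yj = ≤-trans (between⁺ (<ᵇ⇒< (x j) (x i) q) xi≤yj) (m≤m+n _ _)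
  ... | no  xi≰yj = ≤-trans (between⁺ (<ᵇ⇒< (y i) (y j) p) (<⇒≤ (≰⇒> xi≰yj))) (m≤n+m _ (𝟙 (between (x j) (x i) (y j))))
  -- Each kind of charge is summed first over the index whose value lies in the interval; the
  -- interval length is a displacement of the other index. Two kinds of charge and two orders of
  -- each pair give the factor 4.
  I≤ : I ≤ F + F
  I≤ = begin
    I
      ≤⟨ ∑-upTo-mono n (λ i _ → ≤-trans (∑-upTo-mono n λ j _ → 𝟙≤ (inv i j) (charge i j)) (≤-reflexive (∑-+ (upTo n) _ _))) ⟩
    ∑ (upTo n) (λ i → ∑ (upTo n) (λ j → 𝟙 (between (x j) (x i) (y j))) + ∑ (upTo n) (λ j → 𝟙 (between (y i) (y j) (x i))))
      ≡⟨ ∑-+ (upTo n) _ _ ⟩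
    ∑ (upTo n) (λ i → ∑ (upTo n) λ j → 𝟙 (between (x j) (x i) (y j)))
      + ∑ (upTo n) (λ i → ∑ (upTo n) λ j → 𝟙 (between (y i) (y j) (x i)))
      ≡⟨ cong (_+ ∑ (upTo n) (λ i → ∑ (upTo n) λ j → 𝟙 (between (y i) (y j) (x i))))
              (∑-swap (upTo n) (upTo n) (λ i j → 𝟙 (between (x j) (x i) (y j)))) ⟩
    ∑ (upTo n) (λ j → ∑ (upTo n) λ i → 𝟙 (between (x j) (x i) (y j)))
      + ∑ (upTo n) (λ i → ∑ (upTo n) λ j → 𝟙 (between (y i) (y j) (x i)))
      ≤⟨ +-mono-≤
           (∑-upTo-mono n λ j _ → ≤-trans (count-between n x (x j) (y j) x-inj)
             (≤-trans (m∸n≤∣m-n∣ (y j) (x j)) (≤-reflexive (∣-∣-comm (y j) (x j)))))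
           (∑-upTo-mono n λ i _ → ≤-trans (count-between n y (y i) (x i) y-inj) (m∸n≤∣m-n∣ (x i) (y i))) ⟩
    F + F ∎

-- Second moment of the final rank.

rankPotential : ∀ t s → Vec (Fin s) s → ℕ
rankPotential t s σ = potential (2 + t) (suc (relRank (order σ) t)) (suc s) (suc (at σ t))

-- At s = t + 1 the square vanishes and only the reserve, at most (2 + t)³, is left. Each later
-- insertion multiplies the mean by at most (M + 1)² / M², and these factors telescope.
∑-rankPotential : ∀ t s → t < s →
  ∑ (perms s) (rankPotential t s) ≤ length (perms s) * (suc s * suc s * (2 + t))
∑-rankPotential t (suc s) (s≤s t≤s) with m≤n⇒m<n∨m≡n t≤s
... | inj₂ refl = ∑-≤-length (perms (suc s)) bound
  where
  open ≤-Reasoning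
  bound : ∀ σ → σ ∈ perms (suc s) → rankPotential s (suc s) σ ≤ (2 + s) * (2 + s) * (2 + s)
  bound σ σ∈
    with τ , r , τ∈ , _ , refl ← ∈-cartesianProductWith⁻ insertLast (perms s) (allFin (suc s)) σ∈
    = begin
    potential (2 + s) (suc (relRank (order (insertLast τ r)) s)) (2 + s) (suc (at (insertLast τ r) s))
      ≡⟨ cong₂ (λ y Y → potential (2 + s) (suc y) (2 + s) (suc Y))
               (relRank-insertLast-≡ τ∈ r) (at-insertLast-≡ τ r) ⟩
    potential (2 + s) (suc (toℕ r)) (2 + s) (suc (toℕ r))
      ≡⟨ potential-diag (2 + s) (suc (toℕ r)) ⟩
    (2 + s) * (2 + s) * suc (toℕ r)
      ≤⟨ *-monoʳ-≤ ((2 + s) * (2 + s)) (m≤n⇒m≤1+n (toℕ<n r)) ⟩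
    (2 + s) * (2 + s) * (2 + s) ∎
... | inj₁ t<s = *-cancelˡ-≤ M (begin
  M * ∑ (perms (suc s)) (rankPotential t (suc s))
    ≡⟨ cong (M *_) (∑-cartesianProductWith insertLast (perms s) (allFin (suc s)) _) ⟩
  M * ∑ (perms s) (λ τ → ∑ (allFin (suc s)) λ r → rankPotential t (suc s) (insertLast τ r))
    ≡⟨ cong (M *_) (∑-cong (perms s) λ τ _ → trans (∑-cong (allFin (suc s)) λ r _ →
         cong₂ (λ y Y → potential (2 + t) (suc y) (suc M) (suc Y))
               (relRank-insertLast-< τ r t<s) (at-insertLast-< τ r t<s))
         (∑-allFin (suc s) (λ c → P τ (suc M) (suc (pin c (at τ t)))))) ⟩
  M * ∑ (perms s) (λ τ → ∑ (upTo M) λ c → P τ (suc M) (suc (pin c (at τ t))))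
    ≡⟨ ∑-*ˡ M (perms s) _ ⟨
  ∑ (perms s) (λ τ → M * ∑ (upTo M) λ c → P τ (suc M) (suc (pin c (at τ t))))
    ≤⟨ ∑-mono (perms s) (λ τ _ → potential-step (2 + t) (suc (relRank (order τ) t)) M (at τ t) (m<n⇒m<1+n (at< τ t<s))) ⟩
  ∑ (perms s) (λ τ → suc M * suc M * rankPotential t s τ)
    ≡⟨ ∑-*ˡ (suc M * suc M) (perms s) (rankPotential t s) ⟩
  suc M * suc M * ∑ (perms s) (rankPotential t s)
    ≤⟨ *-monoʳ-≤ (suc M * suc M) (∑-rankPotential t s t<s) ⟩
  suc M * suc M * (length (perms s) * (M * M * (2 + t)))
    ≡⟨ rearrange (length (perms s)) s t ⟩
  M * (length (perms s) * M * (suc M * suc M * (2 + t)))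
    ≡⟨ cong (λ l → M * (l * (suc M * suc M * (2 + t)))) (perms-suc s) ⟨
  M * (length (perms (suc s)) * (suc M * suc M * (2 + t))) ∎)
  where
  open ≤-Reasoning
  M : ℕ
  M = suc s
  P : Vec (Fin s) s → ℕ → ℕ → ℕ
  P τ = potential (2 + t) (suc (relRank (order τ) t))
  rearrange : ∀ l s t → let M = suc s in
    suc M * suc M * (l * (M * M * (2 + t))) ≡ M * (l * M * (suc M * suc M * (2 + t)))
  rearrange = solve-∀

-- The outcome space and the second moment of a slot.

module _ (n : ℕ) where

  -- The sum over the outcomes of the first s rounds.
  ∑Ω : ∀ s → (Vec (Fin s) s → (ℕ → ℕ) → ℕ) → ℕ
  ∑Ω s F = ∑ (perms s) λ σ → ∑ (seedFunctions n s) (F σ)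

  size : ℕ → ℕ
  size s = length (perms s) * length (seedFunctions n s)

  size-suc : ∀ s → size (suc s) ≡ size s * (suc s * room n s)
  size-suc s = trans (cong₂ _*_ (perms-suc s) (seedFunctions-suc n s)) (lem (length (perms s)) _ _ _)
    where
    lem : ∀ a b c d → a * b * (c * d) ≡ a * c * (b * d)
    lem = solve-∀

  ∑Ω-cong : ∀ s {F G} → (∀ σ u → σ ∈ perms s → F σ u ≡ G σ u) → ∑Ω s F ≡ ∑Ω s G
  ∑Ω-cong s eq = ∑-cong (perms s) λ σ σ∈ → ∑-cong (seedFunctions n s) λ u _ → eq σ u σ∈

  ∑Ω-mono : ∀ s {F G} → (∀ σ u → F σ u ≤ G σ u) → ∑Ω s F ≤ ∑Ω s G
  ∑Ω-mono s le = ∑-mono (perms s) λ σ _ → ∑-mono (seedFunctions n s) λ u _ → le σ u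

  ∑Ω-*ˡ : ∀ s k F → ∑Ω s (λ σ u → k * F σ u) ≡ k * ∑Ω s F
  ∑Ω-*ˡ s k F = trans (∑-cong (perms s) λ σ _ → ∑-*ˡ k (seedFunctions n s) (F σ)) (∑-*ˡ k (perms s) _)

  ∑Ω-+ : ∀ s F G → ∑Ω s (λ σ u → F σ u + G σ u) ≡ ∑Ω s F + ∑Ω s G
  ∑Ω-+ s F G = trans (∑-cong (perms s) λ σ _ → ∑-+ (seedFunctions n s) (F σ) (G σ)) (∑-+ (perms s) _ _)

  ∑Ω-const : ∀ s k → ∑Ω s (λ _ _ → k) ≡ size s * k
  ∑Ω-const s k = trans (∑-cong (perms s) λ _ _ → ∑-const (seedFunctions n s) k)
    (trans (∑-const (perms s) _) (sym (*-assoc (length (perms s)) _ k)))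

  ∑Ω-swap : ∀ s {A : Set} (xs : List A) (F : Vec (Fin s) s → (ℕ → ℕ) → A → ℕ) →
            ∑Ω s (λ σ u → ∑ xs (F σ u)) ≡ ∑ xs (λ x → ∑Ω s λ σ u → F σ u x)
  ∑Ω-swap s xs F = trans (∑-cong (perms s) λ σ _ → ∑-swap (seedFunctions n s) xs (F σ))
                         (∑-swap (perms s) xs _)

  ∑Ω-suc : ∀ s F → ∑Ω (suc s) F
    ≡ ∑Ω s λ σ u → ∑ (allFin (suc s)) λ r → ∑ (upTo (room n s)) λ w → F (insertLast σ r) (update u s w)
  ∑Ω-suc s F = trans (∑-cartesianProductWith insertLast (perms s) (allFin (suc s)) _)
    (∑-cong (perms s) λ σ _ → trans
      (∑-cong (allFin (suc s)) λ r _ → ∑-cartesianProductWith (λ u w → update u s w) (seedFunctions n s) _ (F (insertLast σ r)))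
      (∑-swap (allFin (suc s)) (seedFunctions n s) _))

  ∑Ω-cauchy-schwarz : ∀ s F → ∑Ω s F * ∑Ω s F ≤ size s * ∑Ω s (λ σ u → F σ u * F σ u)
  ∑Ω-cauchy-schwarz s F = begin
    ∑Ω s F * ∑Ω s F
      ≤⟨ cauchy-schwarz (perms s) _ ⟩
    p * ∑ (perms s) (λ σ → ∑ (seedFunctions n s) (F σ) * ∑ (seedFunctions n s) (F σ))
      ≤⟨ *-monoʳ-≤ p (∑-mono (perms s) λ σ _ → cauchy-schwarz (seedFunctions n s) (F σ)) ⟩
    p * ∑ (perms s) (λ σ → q * ∑ (seedFunctions n s) (λ u → F σ u * F σ u))
      ≡⟨ cong (p *_) (∑-*ˡ q (perms s) _) ⟩
    p * (q * ∑Ω s (λ σ u → F σ u * F σ u))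
      ≡⟨ *-assoc p q _ ⟨
    p * q * ∑Ω s (λ σ u → F σ u * F σ u) ∎
    where
    open ≤-Reasoning
    p q : ℕ
    p = length (perms s)
    q = length (seedFunctions n s)

  chosen : ∀ {s} → Vec (Fin s) s → (ℕ → ℕ) → ℕ → ℕ
  chosen σ u = choices n (order σ) u

  chosen-< : ∀ {s} (σ : Vec (Fin s) s) u r w {i} → i < s →
             chosen (insertLast σ r) (update u s w) i ≡ chosen σ u i
  chosen-< σ u r w {i} i<s = cong₂ (quantile n i) (relRank-insertLast-< σ r i<s) (update-< u w i<s)

  chosen-≡ : ∀ {s σ} → σ ∈ perms s → ∀ u r w →
             chosen (insertLast σ r) (update u s w) s ≡ quantile n s (toℕ r) w
  chosen-≡ {s} σ∈ u r w = cong₂ (quantile n s) (relRank-insertLast-≡ σ∈ r) (update-≡ u s w)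

  ∑-quantile : ∀ s f → ∑ (allFin (suc s)) (λ r → ∑ (upTo (room n s)) λ w → f (quantile n s (toℕ r) w))
                         ≡ suc s * ∑ (upTo (room n s)) f
  ∑-quantile s f = begin
    ∑ (allFin (suc s)) (λ r → ∑ (upTo m) λ w → f (quantile n s (toℕ r) w))
      ≡⟨ ∑-allFin (suc s) (λ r → ∑ (upTo m) λ w → f (quantile n s r w)) ⟩
    ∑ (upTo (suc s)) (λ r → ∑ (upTo m) λ w → f (quantile n s r w))
      ≡⟨ ∑-upTo-cong (suc s) (λ r _ → ∑-upTo-cong m λ w w<m → cong (λ w → f ((r * m + w) / suc s)) (m<n⇒m%n≡m w<m)) ⟩
    ∑ (upTo (suc s)) (λ r → ∑ (upTo m) λ w → f ((r * m + w) / suc s))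
      ≡⟨ ∑-upTo-* (suc s) m (λ x → f (x / suc s)) ⟩
    ∑ (upTo (suc s * m)) (λ x → f (x / suc s))
      ≡⟨ cong (λ k → ∑ (upTo k) (λ x → f (x / suc s))) (*-comm (suc s) m) ⟩
    ∑ (upTo (m * suc s)) (λ x → f (x / suc s))
      ≡⟨ ∑-quotients (suc s) m f ⟩
    suc s * ∑ (upTo m) f ∎
    where
    open ≡-Reasoning
    m : ℕ
    m = room n s

  -- The last choice is uniform and independent of the earlier rounds.
  ∑Ω-choice : ∀ s (F : Vec (Fin (suc s)) (suc s) → (ℕ → ℕ) → ℕ) (G : Vec (Fin s) s → (ℕ → ℕ) → ℕ → ℕ) →
    (∀ σ u r w → σ ∈ perms s → F (insertLast σ r) (update u s w) ≡ G σ u (quantile n s (toℕ r) w)) →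
    ∑Ω (suc s) F ≡ suc s * ∑ (upTo (room n s)) (λ q → ∑Ω s λ σ u → G σ u q)
  ∑Ω-choice s F G eq = begin
    ∑Ω (suc s) F
      ≡⟨ ∑Ω-suc s F ⟩
    ∑Ω s (λ σ u → ∑ (allFin (suc s)) λ r → ∑ (upTo (room n s)) λ w → F (insertLast σ r) (update u s w))
      ≡⟨ ∑Ω-cong s (λ σ u σ∈ → trans
           (∑-cong (allFin (suc s)) λ r _ → ∑-cong (upTo (room n s)) λ w _ → eq σ u r w σ∈)
           (∑-quantile s (G σ u))) ⟩
    ∑Ω s (λ σ u → suc s * ∑ (upTo (room n s)) (G σ u))
      ≡⟨ ∑Ω-*ˡ s (suc s) _ ⟩
    suc s * ∑Ω s (λ σ u → ∑ (upTo (room n s)) (G σ u))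
      ≡⟨ cong (suc s *_) (∑Ω-swap s (upTo (room n s)) G) ⟩
    suc s * ∑ (upTo (room n s)) (λ q → ∑Ω s λ σ u → G σ u q) ∎
    where open ≡-Reasoning

  unrollSum : ℕ → ℕ → ℕ → ℕ → ℕ
  unrollSum β z s v = ∑Ω s λ σ u → potential β z (suc n) (suc (unroll (chosen σ u) s v))

  -- The mirror image of the rank estimate, with time running backwards. For fixed `v`, averaging
  -- over the choice q of the last round replaces `v` by `pin q v` among one more free slot, which
  -- is one `potential-step`. The induction needs every `v`, since it continues from each `pin q v`.
  ∑Ω-unroll : ∀ β z s v → s ≤ n → v < n ∸ s →
    suc (n ∸ s) * suc (n ∸ s) * unrollSum β z s v
      ≤ size s * (suc n * suc n) * potential β z (suc (n ∸ s)) (suc v)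
  ∑Ω-unroll β z zero    v _   _   = ≤-reflexive (lem (suc n * suc n) (potential β z (suc n) (suc v)))
    where
    lem : ∀ N p → N * (p + 0 + 0) ≡ 1 * N * p
    lem = solve-∀
  ∑Ω-unroll β z (suc s) v s<n v<m = begin
    m * m * unrollSum β z (suc s) v
      ≡⟨ cong (m * m *_) (∑Ω-choice s _ G λ σ u r w σ∈ →
           cong (λ k → potential β z (suc n) (suc k)) (trans
             (cong (λ q → unroll (chosen (insertLast σ r) (update u s w)) s (pin q v)) (chosen-≡ σ∈ u r w))
             (unroll-cong s _ λ i i<s → chosen-< σ u r w i<s))) ⟩
    m * m * (suc s * ∑ (upTo m) (λ q → unrollSum β z s (pin q v)))
      ≡⟨ regroup m (suc s) _ ⟩
    suc s * m * (m * ∑ (upTo m) (λ q → unrollSum β z s (pin q v)))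
      ≤⟨ *-monoʳ-≤ (suc s * m) step ⟩
    suc s * m * (size s * N * potential β z m (suc v))
      ≡⟨ regroup′ (suc s * m) (size s) N _ ⟩
    size s * (suc s * m) * N * potential β z m (suc v)
      ≡⟨ cong (λ k → k * N * potential β z m (suc v)) (size-suc s) ⟨
    size (suc s) * N * potential β z m (suc v) ∎
    where
    open ≤-Reasoning
    m N : ℕ
    m = room n s
    N = suc n * suc n
    G : Vec (Fin s) s → (ℕ → ℕ) → ℕ → ℕ
    G σ u q = potential β z (suc n) (suc (unroll (chosen σ u) s (pin q v)))
    regroup : ∀ m a b → m * m * (a * b) ≡ a * m * (m * b)
    regroup = solve-∀
    regroup′ : ∀ a b c d → a * (b * c * d) ≡ b * a * c * d
    regroup′ = solve-∀
    IH : ∀ q → suc m * suc m * unrollSum β z s (pin q v)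
               ≤ size s * N * potential β z (suc m) (suc (pin q v))
    IH q = subst (λ k → suc k * suc k * unrollSum β z s (pin q v)
                        ≤ size s * N * potential β z (suc k) (suc (pin q v)))
      (sym (room≡ s<n))
      (∑Ω-unroll β z s (pin q v) (<⇒≤ s<n) (subst (pin q v <_) (room≡ s<n) (pin-< q v<m)))
    step : m * ∑ (upTo m) (λ q → unrollSum β z s (pin q v)) ≤ size s * N * potential β z m (suc v)
    step = *-cancelˡ-≤ (suc m * suc m) (begin
      suc m * suc m * (m * ∑ (upTo m) (λ q → unrollSum β z s (pin q v)))
        ≡⟨ x∙yz≈y∙xz (suc m * suc m) m (∑ (upTo m) λ q → unrollSum β z s (pin q v)) ⟩
      m * (suc m * suc m * ∑ (upTo m) (λ q → unrollSum β z s (pin q v)))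
        ≡⟨ cong (m *_) (∑-*ˡ (suc m * suc m) (upTo m) (λ q → unrollSum β z s (pin q v))) ⟨
      m * ∑ (upTo m) (λ q → suc m * suc m * unrollSum β z s (pin q v))
        ≤⟨ *-monoʳ-≤ m (∑-upTo-mono m λ q _ → IH q) ⟩
      m * ∑ (upTo m) (λ q → size s * N * potential β z (suc m) (suc (pin q v)))
        ≡⟨ cong (m *_) (∑-*ˡ (size s * N) (upTo m) _) ⟩
      m * (size s * N * ∑ (upTo m) (λ q → potential β z (suc m) (suc (pin q v))))
        ≡⟨ x∙yz≈y∙xz m (size s * N) _ ⟩
      size s * N * (m * ∑ (upTo m) (λ q → potential β z (suc m) (suc (pin q v))))
        ≤⟨ *-monoʳ-≤ (size s * N) (potential-step β z m v (m<n⇒m<1+n v<m)) ⟩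
      size s * N * (suc m * suc m * potential β z m (suc v))
        ≡⟨ x∙yz≈y∙xz (size s * N) (suc m * suc m) _ ⟩
      suc m * suc m * (size s * N * potential β z m (suc v)) ∎)
      where
      x∙yz≈y∙xz : ∀ x y z → x * (y * z) ≡ y * (x * z)
      x∙yz≈y∙xz = solve-∀

  slotPotential : ℕ → ∀ s → Vec (Fin s) s → (ℕ → ℕ) → ℕ
  slotPotential t s σ u =
    potential (suc (room n t)) (suc (chosen σ u t)) (suc n) (suc (slot (chosen σ u) t))

  -- Rounds after `t` do not move the slot, so they only rescale the sum. At round `t` itself one
  -- conditions on the choice q and unrolls from q; the starting potential is diagonal, leaving only
  -- its reserve, at most β³.
  ∑Ω-slotPotential : ∀ t s → t < s → s ≤ n →
    ∑Ω s (slotPotential t s) ≤ size s * (suc n * suc n * suc (room n t))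
  ∑Ω-slotPotential t (suc s) (s≤s t≤s) s<n with m≤n⇒m<n∨m≡n t≤s
  ... | inj₁ t<s = begin
    ∑Ω (suc s) (slotPotential t (suc s))
      ≡⟨ ∑Ω-choice s _ (λ σ u _ → slotPotential t s σ u) (λ σ u r w _ →
           cong₂ (λ z Z → potential (suc (room n t)) (suc z) (suc n) (suc Z))
             (chosen-< σ u r w t<s) (slot-cong t λ i i≤t → chosen-< σ u r w (≤-<-trans i≤t t<s))) ⟩
    suc s * ∑ (upTo (room n s)) (λ _ → ∑Ω s (slotPotential t s))
      ≡⟨ cong (suc s *_) (trans (∑-const (upTo (room n s)) _) (cong (_* ∑Ω s (slotPotential t s)) (length-upTo (room n s)))) ⟩
    suc s * (room n s * ∑Ω s (slotPotential t s))
      ≤⟨ *-monoʳ-≤ (suc s) (*-monoʳ-≤ (room n s) (∑Ω-slotPotential t s t<s (<⇒≤ s<n))) ⟩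
    suc s * (room n s * (size s * K))
      ≡⟨ lem (suc s) (room n s) (size s) K ⟩
    size s * (suc s * room n s) * K
      ≡⟨ cong (_* K) (size-suc s) ⟨
    size (suc s) * K ∎
    where
    open ≤-Reasoning
    K : ℕ
    K = suc n * suc n * suc (room n t)
    lem : ∀ a b c d → a * (b * (c * d)) ≡ c * (a * b) * d
    lem = solve-∀
  ... | inj₂ refl = begin
    ∑Ω (suc s) (slotPotential s (suc s))
      ≡⟨ ∑Ω-choice s _ G (λ σ u r w σ∈ → trans
           (cong (λ q → potential β (suc q) (suc n) (suc (unroll (chosen (insertLast σ r) (update u s w)) s q))) (chosen-≡ σ∈ u r w))
           (cong (λ k → potential β (suc (quantile n s (toℕ r) w)) (suc n) (suc k)) (unroll-cong s _ λ i i<s → chosen-< σ u r w i<s))) ⟩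
    suc s * ∑ (upTo m) (λ q → unrollSum β (suc q) s q)
      ≤⟨ *-monoʳ-≤ (suc s) (∑-upTo-mono m term) ⟩
    suc s * ∑ (upTo m) (λ _ → size s * K)
      ≡⟨ cong (suc s *_) (trans (∑-const (upTo m) _) (cong (_* (size s * K)) (length-upTo m))) ⟩
    suc s * (m * (size s * K))
      ≡⟨ lem (suc s) m (size s) K ⟩
    size s * (suc s * m) * K
      ≡⟨ cong (_* K) (size-suc s) ⟨
    size (suc s) * K ∎
    where
    open ≤-Reasoning
    m β K : ℕ
    m = room n s
    β = suc m
    K = suc n * suc n * β
    lem : ∀ a b c d → a * (b * (c * d)) ≡ c * (a * b) * d
    lem = solve-∀
    lem′ : ∀ a b c d → a * b * (c * d) ≡ c * (a * (b * d))
    lem′ = solve-∀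
    G : Vec (Fin s) s → (ℕ → ℕ) → ℕ → ℕ
    G σ u q = potential β (suc q) (suc n) (suc (unroll (chosen σ u) s q))
    term : ∀ q → q < m → unrollSum β (suc q) s q ≤ size s * K
    term q q<m = *-cancelˡ-≤ (β * β) (begin
      β * β * unrollSum β (suc q) s q
        ≤⟨ subst (λ k → suc k * suc k * unrollSum β (suc q) s q
                        ≤ size s * (suc n * suc n) * potential β (suc q) (suc k) (suc q))
             (sym (room≡ s<n)) (∑Ω-unroll β (suc q) s q (<⇒≤ s<n) (subst (q <_) (room≡ s<n) q<m)) ⟩
      size s * (suc n * suc n) * potential β (suc q) β (suc q)
        ≡⟨ cong (size s * (suc n * suc n) *_) (potential-diag β (suc q)) ⟩
      size s * (suc n * suc n) * (β * β * suc q)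
        ≤⟨ *-monoʳ-≤ (size s * (suc n * suc n)) (*-monoʳ-≤ (β * β) (m≤n⇒m≤1+n q<m)) ⟩
      size s * (suc n * suc n) * (β * β * β)
        ≡⟨ lem′ (size s) (suc n * suc n) (β * β) β ⟩
      β * β * (size s * (suc n * suc n * β)) ∎)

-- Second moment of the displacement.

∣-∣≤ : ∀ {a b k} → a ≤ b + k → b ≤ a + k → ∣ a - b ∣ ≤ k
∣-∣≤ {a} {b} {k} a≤ b≤ with ∣m-n∣≡[m∸n]∨[n∸m] a b
... | inj₁ eq = subst (_≤ k) (sym eq) (m≤n+o⇒m∸n≤o a b a≤)
... | inj₂ eq = subst (_≤ k) (sym eq) (m≤n+o⇒m∸n≤o b a b≤)

-- Writing m for the room and c for the quantile, the floor keeps r * m ≤ (c + 1)(t + 1), and the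
-- seed adds at most m, so c (t + 1) ≤ r * m + m. Passing to 1-based ranks and the scales t + 2 and
-- m + 1 stays within the stated bound.
quantile-close : ∀ n t {r} u → r ≤ t →
  ∣ suc (room n t) * suc r - (2 + t) * suc (quantile n t r u) ∣ ≤ 2 + t + suc (room n t)
quantile-close n t {r} u r≤t = ∣-∣≤ {suc m * suc r} {(2 + t) * suc c}
  (begin
    suc m * suc r                               ≡⟨ e₁ m r ⟩
    r * m + (r + suc m)                         ≤⟨ +-mono-≤ upper (+-monoˡ-≤ (suc m) r≤t) ⟩
    suc c * suc t + (t + suc m)                 ≤⟨ m≤m+n _ (suc c + 2) ⟩
    suc c * suc t + (t + suc m) + (suc c + 2)   ≡⟨ e₂ c t m ⟩
    (2 + t) * suc c + (2 + t + suc m)           ∎)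
  (begin
    (2 + t) * suc c                             ≡⟨ e₃ c t ⟩
    c * suc t + (c + (2 + t))                   ≤⟨ +-mono-≤ lower (+-monoˡ-≤ (2 + t) (<⇒≤ (quantile< n t u r≤t))) ⟩
    r * m + m + (m + (2 + t))                   ≤⟨ m≤m+n _ (2 + r) ⟩
    r * m + m + (m + (2 + t)) + (2 + r)         ≡⟨ e₄ r m t ⟩
    suc m * suc r + (2 + t + suc m)             ∎)
  where
  open ≤-Reasoning
  m c : ℕ
  m = room n t
  c = quantile n t r u
  e₁ : ∀ m r → suc m * suc r ≡ r * m + (r + suc m)
  e₁ = solve-∀
  e₂ : ∀ c t m → suc c * suc t + (t + suc m) + (suc c + 2) ≡ (2 + t) * suc c + (2 + t + suc m)
  e₂ = solve-∀
  e₃ : ∀ c t → (2 + t) * suc c ≡ c * suc t + (c + (2 + t))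
  e₃ = solve-∀
  e₄ : ∀ r m t → r * m + m + (m + (2 + t)) + (2 + r) ≡ suc m * suc r + (2 + t + suc m)
  e₄ = solve-∀
  lower : c * suc t ≤ r * m + m
  lower = ≤-trans (m/n*n≤m (r * m + u % m) (suc t)) (+-monoʳ-≤ (r * m) (<⇒≤ (m%n<n u m)))
  upper : r * m ≤ suc c * suc t
  upper = begin
    r * m                                       ≤⟨ m≤m+n (r * m) (u % m) ⟩
    r * m + u % m                               ≡⟨ m≡m%n+[m/n]*n (r * m + u % m) (suc t) ⟩
    (r * m + u % m) % suc t + c * suc t         ≤⟨ +-monoˡ-≤ (c * suc t) (<⇒≤ (m%n<n (r * m + u % m) (suc t))) ⟩
    suc c * suc t                               ∎

square-mono : ∀ {a b} → a ≤ b → a * a ≤ b * b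
square-mono a≤b = *-mono-≤ a≤b a≤b

square-sum₃ : ∀ a b c → (a + b + c) * (a + b + c) ≤ 3 * (a * a + b * b + c * c)
square-sum₃ a b c = begin
  (a + b + c) * (a + b + c)
    ≡⟨ e₁ a b c ⟩
  a * a + b * b + c * c + (2 * (a * b) + 2 * (a * c) + 2 * (b * c))
    ≤⟨ +-monoʳ-≤ (a * a + b * b + c * c) (+-mono-≤ (+-mono-≤ (2ab≤a²+b² a b) (2ab≤a²+b² a c)) (2ab≤a²+b² b c)) ⟩
  a * a + b * b + c * c + (a * a + b * b + (a * a + c * c) + (b * b + c * c))
    ≡⟨ e₂ (a * a) (b * b) (c * c) ⟩
  3 * (a * a + b * b + c * c) ∎
  where
  open ≤-Reasoning
  e₁ : ∀ a b c → (a + b + c) * (a + b + c) ≡ a * a + b * b + c * c + (2 * (a * b) + 2 * (a * c) + 2 * (b * c))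
  e₁ = solve-∀
  e₂ : ∀ a b c → a + b + c + (a + b + (a + c) + (b + c)) ≡ 3 * (a + b + c)
  e₂ = solve-∀

-- Y ≈ N y / α, y / α ≈ z / β and Z ≈ N z / β give Y ≈ Z.
distance-split : ∀ α β N Y Z y z →
  α * β * ∣ Y - Z ∣ ≤ β * ∣ α * Y - N * y ∣ + N * ∣ β * y - α * z ∣ + α * ∣ β * Z - N * z ∣
distance-split α β N Y Z y z = begin
  α * β * ∣ Y - Z ∣
    ≡⟨ *-distribˡ-∣-∣ (α * β) Y Z ⟩
  ∣ α * β * Y - α * β * Z ∣
    ≤⟨ ∣-∣-triangle (α * β * Y) (α * (N * z)) (α * β * Z) ⟩
  ∣ α * β * Y - α * (N * z) ∣ + ∣ α * (N * z) - α * β * Z ∣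
    ≤⟨ +-monoˡ-≤ _ (∣-∣-triangle (α * β * Y) (β * (N * y)) (α * (N * z))) ⟩
  ∣ α * β * Y - β * (N * y) ∣ + ∣ β * (N * y) - α * (N * z) ∣ + ∣ α * (N * z) - α * β * Z ∣
    ≡⟨ cong₂ _+_ (cong₂ _+_
         (trans (cong (λ k → ∣ k - β * (N * y) ∣) (e₁ α β Y)) (sym (*-distribˡ-∣-∣ β (α * Y) (N * y))))
         (trans (cong₂ ∣_-_∣ (e₂ β N y) (e₂ α N z)) (sym (*-distribˡ-∣-∣ N (β * y) (α * z)))))
         (trans (cong (λ k → ∣ α * (N * z) - k ∣) (*-assoc α β Z))
           (trans (sym (*-distribˡ-∣-∣ α (N * z) (β * Z))) (cong (α *_) (∣-∣-comm (N * z) (β * Z))))) ⟩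
  β * ∣ α * Y - N * y ∣ + N * ∣ β * y - α * z ∣ + α * ∣ β * Z - N * z ∣ ∎
  where
  open ≤-Reasoning
  e₁ : ∀ α β Y → α * β * Y ≡ β * (α * Y)
  e₁ = solve-∀
  e₂ : ∀ b N y → b * (N * y) ≡ N * (b * y)
  e₂ = solve-∀

module _ (n : ℕ) where

  displacement : ℕ → Vec (Fin n) n → (ℕ → ℕ) → ℕ
  displacement t σ u = ∣ at σ t - slot (chosen n σ u) t ∣

  private
    α β : ℕ → ℕ
    α t = 2 + t
    β t = suc (room n t)
    N : ℕ
    N = suc n

  -- The factor 3 comes from squaring a sum of three errors. The rank and slot errors are bounded by
  -- their potentials on dropping the reserves, the middle one pointwise by `quantile-close`.
  displacement²≤ : ∀ t σ u →
    α t * β t * (α t * β t) * (displacement t σ u * displacement t σ u)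
      ≤ 3 * (β t * β t * rankPotential t n σ + N * N * ((α t + β t) * (α t + β t)) + α t * α t * slotPotential n t n σ u)
  displacement²≤ t σ u = begin
    a * b * (a * b) * (D * D)
      ≡⟨ square-* (a * b) D ⟩
    a * b * D * (a * b * D)
      ≤⟨ square-mono (distance-split a b N (suc (at σ t)) (suc (slot c t)) y z) ⟩
    (b * Δr + N * Δq + a * Δs) * (b * Δr + N * Δq + a * Δs)
      ≤⟨ square-sum₃ (b * Δr) (N * Δq) (a * Δs) ⟩
    3 * (b * Δr * (b * Δr) + N * Δq * (N * Δq) + a * Δs * (a * Δs))
      ≡⟨ cong (3 *_) (cong₂ _+_ (cong₂ _+_ (square-* b Δr) (square-* N Δq)) (square-* a Δs)) ⟨
    3 * (b * b * (Δr * Δr) + N * N * (Δq * Δq) + a * a * (Δs * Δs))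
      ≤⟨ *-monoʳ-≤ 3 (+-mono-≤ (+-mono-≤
           (*-monoʳ-≤ (b * b) (m≤m+n (Δr * Δr) _))
           (*-monoʳ-≤ (N * N) (square-mono (quantile-close n t (u t) (relRank≤ (order σ) t)))))
           (*-monoʳ-≤ (a * a) (m≤m+n (Δs * Δs) _))) ⟩
    3 * (b * b * rankPotential t n σ + N * N * ((a + b) * (a + b)) + a * a * slotPotential n t n σ u) ∎
    where
    open ≤-Reasoning
    c : ℕ → ℕ
    c = chosen n σ u
    a b y z D Δr Δq Δs : ℕ
    a = α t
    b = β t
    y = suc (relRank (order σ) t)
    z = suc (c t)
    D = displacement t σ u
    Δr = ∣ a * suc (at σ t) - N * y ∣
    Δq = ∣ b * y - a * z ∣
    Δs = ∣ b * suc (slot c t) - N * z ∣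
    square-* : ∀ x y → x * x * (y * y) ≡ x * y * (x * y)
    square-* = solve-∀

  -- The rank and slot terms b²a + a²b add up to ab(a + b). The rounding term (a + b)² is at most as
  -- much, because a, b ≥ 2 gives a + b ≤ ab. Hence 6 = 3 · 2.
  ∑Ω-displacement² : ∀ t → t < n →
    α t * β t * ∑Ω n n (λ σ u → displacement t σ u * displacement t σ u)
      ≤ 6 * size n n * (N * N) * (α t + β t)
  ∑Ω-displacement² t t<n = *-cancelˡ-≤ (a * b) (begin
    a * b * (a * b * ∑Ω n n D²)
      ≡⟨ *-assoc (a * b) (a * b) (∑Ω n n D²) ⟨
    a * b * (a * b) * ∑Ω n n D²
      ≡⟨ ∑Ω-*ˡ n n (a * b * (a * b)) D² ⟨
    ∑Ω n n (λ σ u → a * b * (a * b) * D² σ u)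
      ≤⟨ ∑Ω-mono n n (displacement²≤ t) ⟩
    ∑Ω n n (λ σ u → 3 * (b * b * R σ u + N * N * ((a + b) * (a + b)) + a * a * S σ u))
      ≡⟨ ∑Ω-*ˡ n n 3 _ ⟩
    3 * ∑Ω n n (λ σ u → b * b * R σ u + N * N * ((a + b) * (a + b)) + a * a * S σ u)
      ≡⟨ cong (3 *_) (trans (∑Ω-+ n n (λ σ u → b * b * R σ u + N * N * ((a + b) * (a + b))) (λ σ u → a * a * S σ u))
           (cong₂ _+_ (trans (∑Ω-+ n n (λ σ u → b * b * R σ u) (λ _ _ → N * N * ((a + b) * (a + b))))
             (cong₂ _+_ (∑Ω-*ˡ n n (b * b) R) (∑Ω-const n n (N * N * ((a + b) * (a + b))))))
             (∑Ω-*ˡ n n (a * a) S))) ⟩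
    3 * (b * b * ∑Ω n n R + s * (N * N * ((a + b) * (a + b))) + a * a * ∑Ω n n S)
      ≤⟨ *-monoʳ-≤ 3 (+-mono-≤ (+-mono-≤ (*-monoʳ-≤ (b * b) R≤)
           (*-monoʳ-≤ s (*-monoʳ-≤ (N * N) (*-monoˡ-≤ (a + b) a+b≤ab))))
           (*-monoʳ-≤ (a * a) (∑Ω-slotPotential n t n t<n ≤-refl))) ⟩
    3 * (b * b * (s * (N * N * a)) + s * (N * N * (a * b * (a + b))) + a * a * (s * (N * N * b)))
      ≡⟨ collect a b s (N * N) ⟩
    a * b * (6 * s * (N * N) * (a + b)) ∎)
    where
    open ≤-Reasoning
    a b s : ℕ
    a = α t
    b = β t
    s = size n n
    D² R S : Vec (Fin n) n → (ℕ → ℕ) → ℕ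
    D² σ u = displacement t σ u * displacement t σ u
    R σ u = rankPotential t n σ
    S = slotPotential n t n
    collect : ∀ a b s N → 3 * (b * b * (s * (N * a)) + s * (N * (a * b * (a + b))) + a * a * (s * (N * b)))
                            ≡ a * b * (6 * s * N * (a + b))
    collect = solve-∀
    a+b≤ab : a + b ≤ a * b
    a+b≤ab = subst (a + b ≤_) (lem t (n ∸ suc t)) (m≤m+n (a + b) _)
      where
      lem : ∀ x y → 2 + x + (2 + y) + (x + y + x * y) ≡ (2 + x) * (2 + y)
      lem = solve-∀
    p q : ℕ
    p = length (perms n)
    q = length (seedFunctions n n)
    R≤ : ∑Ω n n R ≤ s * (N * N * a)
    R≤ = begin
      ∑Ω n n R                              ≡⟨ ∑-cong (perms n) (λ σ _ → ∑-const (seedFunctions n n) (rankPotential t n σ)) ⟩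
      ∑ (perms n) (λ σ → q * rankPotential t n σ) ≡⟨ ∑-*ˡ q (perms n) (rankPotential t n) ⟩
      q * ∑ (perms n) (rankPotential t n)   ≤⟨ *-monoʳ-≤ q (∑-rankPotential t n t<n) ⟩
      q * (p * (N * N * a))                 ≡⟨ lem q p (N * N * a) ⟩
      p * q * (N * N * a)                   ∎
      where
      lem : ∀ q p x → q * (p * x) ≡ p * q * x
      lem = solve-∀

  -- Summing the displacements over time.

  totalDisplacement : ℕ → ℕ
  totalDisplacement t = ∑Ω n n (displacement t)

  private
    J : ℕ
    J = 12 * (size n n * size n n) * (N * N)

  totalDisplacement² : ∀ t → t < n →
    totalDisplacement t * totalDisplacement t * (α t * β t)
      ≤ 6 * (size n n * size n n) * (N * N) * (α t + β t)
  totalDisplacement² t t<n = begin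
    totalDisplacement t * totalDisplacement t * (α t * β t)
      ≤⟨ *-monoˡ-≤ (α t * β t) (∑Ω-cauchy-schwarz n n (displacement t)) ⟩
    s * Q * (α t * β t)
      ≡⟨ e₁ s Q (α t * β t) ⟩
    s * (α t * β t * Q)
      ≤⟨ *-monoʳ-≤ s (∑Ω-displacement² t t<n) ⟩
    s * (6 * s * (N * N) * (α t + β t))
      ≡⟨ e₂ s (N * N) (α t + β t) ⟩
    6 * (s * s) * (N * N) * (α t + β t) ∎
    where
    open ≤-Reasoning
    s Q : ℕ
    s = size n n
    Q = ∑Ω n n (λ σ u → displacement t σ u * displacement t σ u)
    e₁ : ∀ s Q k → s * Q * k ≡ s * (k * Q)
    e₁ = solve-∀
    e₂ : ∀ s N k → s * (6 * s * N * k) ≡ 6 * (s * s) * N * k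
    e₂ = solve-∀

  -- For a ≤ b one has 1/a + 1/b ≤ 2/a, which doubles 6 to 12.
  cancel-larger : ∀ Q I a b .{{_ : NonZero b}} → a ≤ b → Q * (a * b) ≤ 6 * I * (N * N) * (a + b) →
                  Q * a ≤ 12 * I * (N * N)
  cancel-larger Q I a b a≤b le = *-cancelʳ-≤ _ _ b (begin
    Q * a * b                      ≡⟨ *-assoc Q a b ⟩
    Q * (a * b)                    ≤⟨ le ⟩
    6 * I * (N * N) * (a + b)      ≤⟨ *-monoʳ-≤ (6 * I * (N * N)) (+-monoˡ-≤ b a≤b) ⟩
    6 * I * (N * N) * (b + b)      ≡⟨ lem I (N * N) b ⟩
    12 * I * (N * N) * b           ∎)
    where
    open ≤-Reasoning
    lem : ∀ I N b → 6 * I * N * (b + b) ≡ 12 * I * N * b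
    lem = solve-∀

  -- Each time is assigned to the smaller of its two scales, so that a single inverse square root
  -- bounds it. The zeros elsewhere let both sequences satisfy the hypothesis of `∑-inverse-sqrt` at
  -- every time.
  early late : ℕ → ℕ
  early t = if α t ≤ᵇ β t then totalDisplacement t else 0
  late  t = if α t ≤ᵇ β t then 0 else totalDisplacement t

  early+late : ∀ t → totalDisplacement t ≡ early t + late t
  early+late t with α t ≤ᵇ β t
  ... | true  = sym (+-identityʳ _)
  ... | false = refl

  early² : ∀ t → t < n → early t * early t * suc t ≤ J
  early² t t<n with α t ≤ᵇ β t in eq
  ... | false = z≤n
  ... | true  = ≤-trans (*-monoʳ-≤ (totalDisplacement t * totalDisplacement t) (n≤1+n (suc t)))
    (cancel-larger (totalDisplacement t * totalDisplacement t) (size n n * size n n) (α t) (β t)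
      (≤ᵇ⇒≤ (α t) (β t) (subst T (sym eq) _)) (totalDisplacement² t t<n))

  late² : ∀ t → t < n → late t * late t * β t ≤ J
  late² t t<n with α t ≤ᵇ β t in eq
  ... | true  = z≤n
  ... | false = cancel-larger (totalDisplacement t * totalDisplacement t) (size n n * size n n) (β t) (α t)
      (<⇒≤ (≰⇒> λ α≤β → subst T eq (≤⇒≤ᵇ α≤β)))
      (subst₂ (λ x y → totalDisplacement t * totalDisplacement t * x ≤ 6 * (size n n * size n n) * (N * N) * y)
        (*-comm (α t) (β t)) (+-comm (α t) (β t)) (totalDisplacement² t t<n))

  ∑-totalDisplacement² :
    ∑ (upTo n) totalDisplacement * ∑ (upTo n) totalDisplacement ≤ 16 * J * n
  ∑-totalDisplacement² = begin
    ∑ (upTo n) totalDisplacement * ∑ (upTo n) totalDisplacement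
      ≡⟨ cong (λ k → k * k) (trans (∑-upTo-cong n λ t _ → early+late t) (∑-+ (upTo n) early late)) ⟩
    (E + L) * (E + L)
      ≡⟨ e₁ E L ⟩
    E * E + L * L + 2 * (E * L)
      ≤⟨ +-monoʳ-≤ (E * E + L * L) (2ab≤a²+b² E L) ⟩
    E * E + L * L + (E * E + L * L)
      ≤⟨ +-mono-≤ both both ⟩
    4 * J * n + 4 * J * n + (4 * J * n + 4 * J * n)
      ≡⟨ e₂ J n ⟩
    16 * J * n ∎
    where
    open ≤-Reasoning
    E L : ℕ
    E = ∑ (upTo n) early
    L = ∑ (upTo n) late
    e₁ : ∀ E L → (E + L) * (E + L) ≡ E * E + L * L + 2 * (E * L)
    e₁ = solve-∀
    e₂ : ∀ J n → 4 * J * n + 4 * J * n + (4 * J * n + 4 * J * n) ≡ 16 * J * n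
    e₂ = solve-∀
    -- Late times are counted from the end: at t = n - 1 - i the scale `β t` is at least i + 1.
    L² : L * L ≤ 4 * J * n
    L² = subst (λ k → k * k ≤ 4 * J * n) (sym (∑-upTo-reverse n late))
      (∑-inverse-sqrt n (λ i → late (n ∸ suc i)) J λ i i<n →
        let t = n ∸ suc i ; t<n = n∸1+i<n i<n in
        ≤-trans (*-monoʳ-≤ (late t * late t) (1+i≤β i<n)) (late² t t<n))
      where
      n∸1+i<n : ∀ {i} → i < n → n ∸ suc i < n
      n∸1+i<n i<n = ∸-monoʳ-< z<s i<n
      1+i≤β : ∀ {i} → i < n → suc i ≤ β (n ∸ suc i)
      1+i≤β {i} i<n = s≤s (begin
        i                      ≤⟨ n≤1+n i ⟩
        suc i                  ≡⟨ m∸[m∸n]≡n i<n ⟨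
        n ∸ (n ∸ suc i)        ≡⟨ room≡ (n∸1+i<n i<n) ⟨
        room n (n ∸ suc i)     ∎)
    both : E * E + L * L ≤ 4 * J * n + 4 * J * n
    both = +-mono-≤ (∑-inverse-sqrt n early J early²) L²

  totalCost≤ : totalCost quantileAlgorithm n ≤ 4 * ∑ (upTo n) totalDisplacement
  totalCost≤ = begin
    totalCost quantileAlgorithm n
      ≡⟨ ∑-isPerm n _ ⟩
    ∑ (perms n) (λ σ → sumFin (length L) λ s → inversions n (position quantileAlgorithm n s σ) (lookup σ))
      ≤⟨ ∑-mono (perms n) (λ σ σ∈ → ∑-mono (allFin (length L)) λ s _ →
           inversions≤footrule n (at σ) (slot (chosen n σ (List.lookup L s))) _ _
             (at-lookup σ) (toℕ-position n s σ) (∈-perms⇒InjectiveAt n σ∈) (λ _ _ → slot-injective _ _ _)) ⟩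
    ∑ (perms n) (λ σ → sumFin (length L) λ s → 4 * ∑ (upTo n) λ t → displacement t σ (List.lookup L s))
      ≡⟨ ∑-cong (perms n) (λ σ _ → ∑-lookup L (λ u → 4 * ∑ (upTo n) λ t → displacement t σ u)) ⟩
    ∑Ω n n (λ σ u → 4 * ∑ (upTo n) λ t → displacement t σ u)
      ≡⟨ ∑Ω-*ˡ n n 4 (λ σ u → ∑ (upTo n) λ t → displacement t σ u) ⟩
    4 * ∑Ω n n (λ σ u → ∑ (upTo n) λ t → displacement t σ u)
      ≡⟨ cong (4 *_) (∑Ω-swap n n (upTo n) (λ σ u t → displacement t σ u)) ⟩
    4 * ∑ (upTo n) totalDisplacement ∎
    where
    open ≤-Reasoning
    L : List (ℕ → ℕ)
    L = seedFunctions n n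

  outcomes≡size : outcomes quantileAlgorithm n ≡ size n n
  outcomes≡size = cong (_* length (seedFunctions n n)) (begin
    ∑ (allVecs n n) (λ σ → 𝟙 (isPerm σ))                   ≡⟨ ∑-cong (allVecs n n) (λ σ _ → 𝟙-if (isPerm σ)) ⟩
    ∑ (allVecs n n) (λ σ → if isPerm σ then 1 else 0)      ≡⟨ ∑-isPerm n (λ _ → 1) ⟩
    ∑ (perms n) (λ _ → 1)                                  ≡⟨ ∑-const (perms n) 1 ⟩
    length (perms n) * 1                                   ≡⟨ *-identityʳ _ ⟩
    length (perms n)                                       ∎)
    where
    open ≡-Reasoning
    𝟙-if : ∀ b → 𝟙 b ≡ (if b then 1 else 0)
    𝟙-if true  = refl
    𝟙-if false = refl

quantileAlgorithm-cost : ExpectedInversionsO-n√n quantileAlgorithm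
-- 16 is the square of the 4 in `totalCost≤`, 16 * 12 comes from the squared total displacement, and
-- 4 from (n + 1)² ≤ (2n)², which is where n ≥ 1 enters.
quantileAlgorithm-cost = 16 * (16 * 12) * 4 , 1 , bound
  where
  open ≤-Reasoning
  bound : ∀ n → 1 ≤ n →
    totalCost quantileAlgorithm n ^ 2 ≤ 16 * (16 * 12) * 4 * n ^ 3 * outcomes quantileAlgorithm n ^ 2
  bound n 1≤n rewrite outcomes≡size n = begin
    totalCost quantileAlgorithm n ^ 2
      ≤⟨ ^-monoˡ-≤ 2 (totalCost≤ n) ⟩
    (4 * S) ^ 2
      ≡⟨ e₁ S ⟩
    16 * (S * S)
      ≤⟨ *-monoʳ-≤ 16 (∑-totalDisplacement² n) ⟩
    16 * (16 * (12 * (s * s) * (suc n * suc n)) * n)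
      ≤⟨ *-monoʳ-≤ 16 (*-monoˡ-≤ n (*-monoʳ-≤ 16 (*-monoʳ-≤ (12 * (s * s)) (square-mono 1+n≤n+n)))) ⟩
    16 * (16 * (12 * (s * s) * ((n + n) * (n + n))) * n)
      ≡⟨ e₂ 16 12 s n ⟩
    16 * (16 * 12) * 4 * n ^ 3 * s ^ 2 ∎
    where
    S s : ℕ
    S = ∑ (upTo n) (totalDisplacement n)
    s = size n n
    1+n≤n+n : suc n ≤ n + n
    1+n≤n+n = +-monoˡ-≤ n 1≤n
    e₁ : ∀ S → 4 * S * (4 * S * 1) ≡ 16 * (S * S)
    e₁ = solve-∀
    e₂ : ∀ a b s n → a * (a * (b * (s * s) * ((n + n) * (n + n))) * n)
                       ≡ a * (a * b) * 4 * (n * (n * (n * 1))) * (s * (s * 1))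
    e₂ = solve-∀

theorem3p1 : Σ Algorithm (λ A → Valid A × ExpectedInversionsO-n√n A)
theorem3p1 = quantileAlgorithm , quantileAlgorithm-valid , quantileAlgorithm-cost
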